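{- Let $n,m,\delta$ be integers with $n \leq \delta \leq m \leq 3\delta-5$. Let $G$ be a bipartite graph with bipartition $(X,Y)$, where $|X| = n \geq 2$, $|Y| = m$, and every vertex $x \in X$ has degree $d(x) \geq \delta$. If $G$ is 2-connected, then $G$ contains a cycle of length $2n$, i.e., a cycle that contains every vertex of $X$. -}

module Defs where

open import Data.Nat using (ℕ; _≤_; _<_)
open import Data.Fin using (Fin)
open import Data.Fin.Subset using (Subset; _∈_; _∉_; ∣_∣; ⊤; _∩_; _∪_; Empty)
open import Data.List using (List; _∷_; _∷ʳ_; length)
open import Data.List.Relation.Unary.Linked using (Linked)
open import Data.List.Relation.Unary.Unique.Propositional using (Unique)
open import Data.Product using (_×_)
open import Relation.Binary.Construct.Closure.ReflexiveTransitive using (Star)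
open import Relation.Binary.PropositionalEquality using (_≡_)
open import Relation.Nullary using (¬_)

-- Finite simple graphs on the vertex set Fin N, given by neighbourhoods;
-- adjacency is therefore decidable.
record Graph (N : ℕ) : Set where
  field
    neighbours : Fin N → Subset N
    symmetric  : ∀ {u v} → v ∈ neighbours u → u ∈ neighbours v
    loopless   : ∀ v → v ∉ neighbours v

  Adjacent : Fin N → Fin N → Set
  Adjacent u v = v ∈ neighbours u

  degree : Fin N → ℕ
  degree v = ∣ neighbours v ∣

open Graph public

module _ {N : ℕ} (G : Graph N) where

  Independent : Subset N → Set
  Independent S = ∀ {u v} → u ∈ S → v ∈ S → ¬ Adjacent G u v

  record Bipartition (X Y : Subset N) : Set where
    field
      covering     : X ∪ Y ≡ ⊤
      disjoint     : Empty (X ∩ Y)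
      independentˡ : Independent X
      independentʳ : Independent Y

  -- Adjacency in the vertex-deleted subgraph G − S.
  AdjacentAvoiding : Subset N → Fin N → Fin N → Set
  AdjacentAvoiding S u v = u ∉ S × v ∉ S × Adjacent G u v

  -- G − S is connected: any two of its vertices are joined by a walk in it.
  ConnectedAfterDeleting : Subset N → Set
  ConnectedAfterDeleting S =
    ∀ {u v} → u ∉ S → v ∉ S → Star (AdjacentAvoiding S) u v

  -- k-connectedness: more than k vertices, and deleting fewer than k of them
  -- never disconnects G (S = ∅ gives connectedness of G itself).
  record IsConnected (k : ℕ) : Set where
    field
      order    : k < N
      deletion : ∀ S → ∣ S ∣ < k → ConnectedAfterDeleting S

  -- A closed walk v , w₁ , … , wᵣ , v, listed without its final vertex.
  data Closed : List (Fin N) → Set where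
    closed : ∀ {v ws} → Linked (Adjacent G) ((v ∷ ws) ∷ʳ v) → Closed (v ∷ ws)

  -- The length of a cycle is the length of its list of vertices.
  record IsCycle (c : List (Fin N)) : Set where
    field
      length≥3 : 3 ≤ length c
      distinct : Unique c
      isClosed : Closed c

{-# OPTIONS --safe #-}
module Submission where

-- Proof idea. Let C be a cycle with the largest number k of vertices of X, and
-- suppose k < n; then k < δ, so every vertex of X has a neighbour off C.
--
-- First let some x ∈ X off C have t ≥ 2 neighbours on C, with (C, x) chosen so
-- that t is largest. By the usual rerouting arguments, x and the successors on
-- C of its neighbours have pairwise disjoint neighbourhoods off C. Take two
-- successors u and w, and cut C before them into arcs A and B. If no vertex v of
-- A (or B) has its two neighbours on C joined to w and u crosswise, then u and w
-- together have at most k + 2 neighbours on C, and counting Y gives m ≥ 3δ − 4.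
-- Otherwise C can be rerouted through x so as to omit just v; then v too has at
-- most t neighbours on C, its neighbourhood off C is again disjoint from the
-- others, and counting with x, v and the other successors gives m ≥ 3δ − 4.
--
-- So every x ∈ X off C has at most one neighbour on C. By 2-connectedness there
-- is an ear E of C, with ends c ≠ c′, that contains a vertex x of X. Let u and w
-- be the first vertices of X after c and c′ on C. A crossing at v yields a cycle
-- through E and all of C ∩ X but v, and v has two neighbours on it, which is
-- impossible. Hence u and w have at most k + 2 neighbours on C in total, the
-- neighbourhoods of x, u and w off C overlap in at most one vertex, and once
-- more m ≥ 3δ − 4.

open import Defs
open import Data.Nat using (ℕ; zero; suc; _+_; _*_; _≤_; _<_; z≤n; s≤s; _≤?_)
open import Data.Nat.Properties
open import Data.Nat.Tactic.RingSolver using (solve-∀)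
open import Data.Nat.ListAction using (sum)
open import Data.Nat.ListAction.Properties using (sum-++; sum-↭)
open import Data.Bool using (true; false; if_then_else_)
open import Data.Empty using (⊥; ⊥-elim)
open import Data.Fin using (Fin)
open import Data.Fin.Patterns using (0F; 1F; 2F; 3F; 4F; 5F; 6F)
import Data.Fin.Properties as Fin
open import Data.Fin.Subset using (Subset; _∈_; _∉_; ∣_∣; ⁅_⁆)
open import Data.Fin.Subset.Properties using (_∈?_; x∈⁅x⁆; x∈⁅y⁆⇒x≡y; ∣⁅x⁆∣≡1; ∈⊤; x∈p∩q⁺; x∈p∪q⁻)
open import Data.List using (List; []; _∷_; _++_; _∷ʳ_; length; map; drop; reverse; allFin; tabulate)
open import Data.List.Properties using (unfold-reverse; ++-assoc; ++-identityʳ; map-++; map-tabulate; ∷-injective)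
open import Data.List.Membership.Propositional using () renaming (_∈_ to _∈ₗ_; _∉_ to _∉ₗ_)
open import Data.List.Membership.Propositional.Properties using (∈-++⁺ˡ; ∈-++⁺ʳ; ∈-++⁻; ∈-∃++; ∈-allFin)
import Data.List.Membership.DecPropositional as DecMembership
open import Data.List.Relation.Unary.All using (All; []; _∷_)
import Data.List.Relation.Unary.All as All
import Data.List.Relation.Unary.All.Properties as All
import Data.List.Relation.Unary.AllPairs as AllPairs
open import Data.List.Relation.Unary.Any using (here; there)
open import Data.List.Relation.Unary.AllPairs using (AllPairs; []; _∷_)
open import Data.List.Relation.Unary.Linked using (Linked; []; [-]; _∷_; linked?)
open import Data.List.Relation.Unary.Unique.Propositional using (Unique)
open import Data.List.Relation.Unary.Unique.Propositional.Properties using (allFin⁺)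
import Data.List.Relation.Unary.Unique.DecPropositional as DecUnique
open import Data.List.Relation.Binary.Permutation.Propositional 
  using (_↭_; prep; ↭-refl; ↭-sym; ↭-trans; ↭-reflexive; ↭⇒↭ₛ)
open import Data.List.Relation.Binary.Permutation.Propositional.Properties
  using (∈-resp-↭; ++-commutativeMonoid; ↭-reverse; shift; map⁺)
  renaming (++⁺ to ↭-++⁺; ++-comm to ↭-++-comm)
open import Data.Product using (∃-syntax; _×_; _,_; proj₁; proj₂)
open import Data.Sum using (_⊎_; inj₁; inj₂)
open import Data.Vec using (Vec; []; _∷_; lookup)
open import Data.Vec.Properties using ([]=⇒lookup; lookup⇒[]=)
open import Function using (_∘_; id; case_of_)
open import Relation.Binary.Construct.Closure.ReflexiveTransitive using (Star; ε; _◅_)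
open import Relation.Binary.PropositionalEquality using (_≡_; _≢_; refl; sym; cong; cong₂; subst; subst₂; setoid)
  renaming (trans to ≡-trans)
open import Relation.Nullary using (¬_; Dec; yes; no)
open import Relation.Nullary.Decidable using (decidable-stable; map′; _×-dec_; _→-dec_)
import Data.List.Relation.Binary.Permutation.Setoid.Properties as Permutationₛ
import Algebra.Solver.CommutativeMonoid.Normal

-- Rearranging lists that are assembled from segments

data Seg (n : ℕ) : Set where
  #_  : Fin n → Seg n
  _⊕_ : Seg n → Seg n → Seg n
  ↶_  : Seg n → Seg n

infixr 5 _⊕_
infix 6 #_ ↶_

module _ {A : Set} where
  private module CM = Algebra.Solver.CommutativeMonoid.Normal (++-commutativeMonoid {A = A})

  assemble : ∀ {n} → Seg n → Vec (List A) n → List A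
  assemble (# i)   ρ = lookup ρ i
  assemble (s ⊕ t) ρ = assemble s ρ ++ assemble t ρ
  assemble (↶ s)   ρ = reverse (assemble s ρ)

  private
    unreversed : ∀ {n} → Seg n → CM.Expr n
    unreversed (# i)   = CM.var i
    unreversed (s ⊕ t) = unreversed s CM.⊕ unreversed t
    unreversed (↶ s)   = unreversed s

    assemble↭ : ∀ {n} (s : Seg n) ρ → assemble s ρ ↭ CM.⟦ unreversed s ⟧ ρ
    assemble↭ (# i)   ρ = ↭-refl
    assemble↭ (s ⊕ t) ρ = ↭-++⁺ (assemble↭ s ρ) (assemble↭ t ρ)
    assemble↭ (↶ s)   ρ = ↭-trans (↭-reverse _) (assemble↭ s ρ)

  -- Up to permutation, order and reversal both disappear, so two segment expressions agree as soon
  -- as their normal forms in the free commutative monoid do. For concrete expressions that equation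
  -- holds by computation, and `refl` proves it.
  rearrange : ∀ {n} (s t : Seg n) → CM.normalise (unreversed s) ≡ CM.normalise (unreversed t) →
    ∀ ρ → assemble s ρ ↭ assemble t ρ
  rearrange s t s≡t ρ =
    ↭-trans (assemble↭ s ρ)
      (↭-trans (↭-sym (CM.correct (unreversed s) ρ))
        (↭-trans (↭-reflexive (cong (λ e → CM.⟦ e ⟧⇓ ρ) s≡t))
          (↭-trans (CM.correct (unreversed t) ρ) (↭-sym (assemble↭ t ρ)))))

  Unique-resp-↭ : ∀ {k l : List A} → k ↭ l → Unique k → Unique l
  Unique-resp-↭ = Permutationₛ.Unique-resp-↭ (setoid A) ∘ ↭⇒↭ₛ

  ∉⇒All≢ : ∀ {x : A} {l} → x ∉ₗ l → All (x ≢_) l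
  ∉⇒All≢ x∉l = All.¬Any⇒All¬ _ x∉l

  All≢⇒∉ : ∀ {x : A} {l} → All (x ≢_) l → x ∉ₗ l
  All≢⇒∉ = All.All¬⇒¬Any

  Unique-++⁻ˡ : ∀ (k : List A) {l} → Unique (k ++ l) → Unique k
  Unique-++⁻ˡ []      _        = []
  Unique-++⁻ˡ (x ∷ k) (p ∷ ps) = All.++⁻ˡ k p ∷ Unique-++⁻ˡ k ps

  Unique-++⁻ʳ : ∀ (k : List A) {l} → Unique (k ++ l) → Unique l
  Unique-++⁻ʳ []      u        = u
  Unique-++⁻ʳ (x ∷ k) (_ ∷ ps) = Unique-++⁻ʳ k ps

  Unique-disjoint : ∀ (k : List A) {l x} → Unique (k ++ l) → x ∈ₗ k → x ∉ₗ l
  Unique-disjoint (_ ∷ k) (p ∷ ps) (here refl) x∈l = All≢⇒∉ p (∈-++⁺ʳ k x∈l)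
  Unique-disjoint (_ ∷ k) (p ∷ ps) (there x∈k) x∈l = Unique-disjoint k ps x∈k x∈l

  Unique-++⁺ : ∀ {k l : List A} → Unique k → Unique l → (∀ {x} → x ∈ₗ k → x ∉ₗ l) → Unique (k ++ l)
  Unique-++⁺ []       ul _   = ul
  Unique-++⁺ (p ∷ ps) ul dis =
    All.++⁺ p (∉⇒All≢ (dis (here refl))) ∷ Unique-++⁺ ps ul (dis ∘ there)

  complement : ∀ {l m : List A} → Unique l → (∀ {x} → x ∈ₗ l → x ∈ₗ m) → ∃[ r ] l ++ r ↭ m
  complement {[]}    {m} _ _ = m , ↭-refl
  complement {x ∷ l} {m} (p ∷ ps) l⊆m with ∈-∃++ (l⊆m (here refl))
  ... | m₁ , m₂ , refl with complement ps (λ y∈l → tail (All.lookup p y∈l) (∈-resp-↭ (shift x m₁ m₂) (l⊆m (there y∈l))))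
    where
    tail : ∀ {y k} → x ≢ y → y ∈ₗ x ∷ k → y ∈ₗ k
    tail x≢y (here y≡x) = ⊥-elim (x≢y (sym y≡x))
    tail x≢y (there y∈) = y∈
  ... | r , l++r↭ = r , ↭-trans (prep x l++r↭) (↭-sym (shift x m₁ m₂))

  -- Equal cuts fall under the first alternative, with `e` empty; in the second, the overhang has a
  -- first element `y`.
  compare-cuts : ∀ (a b c d : List A) → a ++ b ≡ c ++ d →
    (∃[ e ] (c ≡ a ++ e × b ≡ e ++ d)) ⊎ (∃[ y ] ∃[ e ] (a ≡ c ++ y ∷ e × d ≡ y ∷ e ++ b))
  compare-cuts []      b c       d eq   = inj₁ (c , refl , eq)
  compare-cuts (x ∷ a) b []      d refl = inj₂ (x , a , refl , refl)
  compare-cuts (x ∷ a) b (_ ∷ c) d eq with ∷-injective eq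
  ... | refl , eq′ with compare-cuts a b c d eq′
  ... | inj₁ (e , refl , q)     = inj₁ (e , refl , q)
  ... | inj₂ (y , e , refl , q) = inj₂ (y , e , refl , q)

-- Counting the members of a subset along a list

module _ {N : ℕ} where

  χ : Subset N → Fin N → ℕ
  χ S v = if lookup S v then 1 else 0

  χ-∈ : ∀ {S v} → v ∈ S → χ S v ≡ 1
  χ-∈ v∈S rewrite []=⇒lookup v∈S = refl

  χ-∉ : ∀ {S v} → v ∉ S → χ S v ≡ 0
  χ-∉ {S} {v} v∉S with lookup S v in eq
  ... | true  = ⊥-elim (v∉S (lookup⇒[]= v S eq))
  ... | false = refl

  χ≤1 : ∀ S v → χ S v ≤ 1
  χ≤1 S v with lookup S v
  ... | true  = ≤-refl
  ... | false = z≤n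

  χ+χ≤1 : ∀ {S T v w} → ¬ (v ∈ S × w ∈ T) → χ S v + χ T w ≤ 1
  χ+χ≤1 {S} {T} {v} {w} not-both with v ∈? S
  ... | no  v∉S rewrite χ-∉ v∉S = χ≤1 T w
  ... | yes v∈S rewrite χ-∉ {S = T} (λ w∈T → not-both (v∈S , w∈T)) | +-identityʳ (χ S v) = χ≤1 S v

  cnt : Subset N → List (Fin N) → ℕ
  cnt S l = sum (map (χ S) l)

  cnt-++ : ∀ S k l → cnt S (k ++ l) ≡ cnt S k + cnt S l
  cnt-++ S k l = ≡-trans (cong sum (map-++ (χ S) k l)) (sum-++ (map (χ S) k) (map (χ S) l))

  cnt-↭ : ∀ S {k l} → k ↭ l → cnt S k ≡ cnt S l
  cnt-↭ S k↭l = sum-↭ (map⁺ (χ S) k↭l)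

  cnt-∉ : ∀ S {l} → (∀ {v} → v ∈ₗ l → v ∉ S) → cnt S l ≡ 0
  cnt-∉ S {[]}    _ = refl
  cnt-∉ S {v ∷ l} h = cong₂ _+_ (χ-∉ (h (here refl))) (cnt-∉ S (h ∘ there))

  cnt-pos : ∀ S {l} → 1 ≤ cnt S l → ∃[ v ] (v ∈ₗ l × v ∈ S)
  cnt-pos S {v ∷ l} h with v ∈? S
  ... | yes v∈S = v , here refl , v∈S
  ... | no  v∉S with cnt-pos S {l} (subst (λ c → 1 ≤ c + cnt S l) (χ-∉ v∉S) h)
  ... | w , w∈l , w∈S = w , there w∈l , w∈S

  cnt-mono : ∀ S T l → (∀ {v} → v ∈ₗ l → χ S v ≤ χ T v) → cnt S l ≤ cnt T l
  cnt-mono S T []      _ = z≤n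
  cnt-mono S T (v ∷ l) h = +-mono-≤ (h (here refl)) (cnt-mono S T l (h ∘ there))

  ∈⇒1≤cnt : ∀ S {v l} → v ∈ₗ l → v ∈ S → 1 ≤ cnt S l
  ∈⇒1≤cnt S {v} {l} v∈l v∈S with ∈-∃++ v∈l
  ... | l₁ , l₂ , refl rewrite cnt-↭ S (shift v l₁ l₂) | χ-∈ v∈S = s≤s z≤n

  ∈∈⇒2≤cnt : ∀ S {v w l} → v ≢ w → v ∈ₗ l → w ∈ₗ l → v ∈ S → w ∈ S → 2 ≤ cnt S l
  ∈∈⇒2≤cnt S {v} {w} v≢w v∈l w∈l v∈S w∈S with ∈-∃++ v∈l
  ... | l₁ , l₂ , refl rewrite cnt-↭ S (shift v l₁ l₂) | χ-∈ v∈S =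
    s≤s (∈⇒1≤cnt S (tail (∈-resp-↭ (shift v l₁ l₂) w∈l)) w∈S)
    where
    tail : ∀ {k} → w ∈ₗ v ∷ k → w ∈ₗ k
    tail (here w≡v) = ⊥-elim (v≢w (sym w≡v))
    tail (there w∈) = w∈

  cnt-allFin : ∀ S → ∣ S ∣ ≡ cnt S (allFin N)
  cnt-allFin S = ≡-trans (go S) (cong sum (sym (map-tabulate id (χ S))))
    where
    go : ∀ {m} (T : Subset m) → ∣ T ∣ ≡ sum (tabulate (λ v → if lookup T v then 1 else 0))
    go []          = refl
    go (true  ∷ T) = cong suc (go T)
    go (false ∷ T) = go T

-- Arithmetic of the three degree counts

few-edges-arith : ∀ {δ a b yR S L t ox ou ow uA wA uB wB} →
  δ ≤ t + ox → δ ≤ (uA + uB) + ou → δ ≤ (wA + wB) + ow →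
  uA + wA ≤ suc a → wB + uB ≤ suc b → ox + (ou + (ow + S)) ≤ yR → L ≤ S → t ≤ 2 + L →
  ((a + b) + yR) + 5 ≤ 3 * δ → ⊥
few-edges-arith {δ} {a} {b} {yR} {S} {L} {t} {ox} {ou} {ow} {uA} {wA} {uB} {wB} h₁ h₂ h₃ h₄ h₅ h₆ h₇ h₈ h₉ =
  -- All hypotheses are added up. By `balance` their left sides exceed their right sides by exactly
  -- one in total.
  1+n≰n (≤-trans (≤-reflexive (sym (balance δ a b yR S L t ox ou ow uA wA uB wB)))
    (+-mono-≤ h₁ (+-mono-≤ h₂ (+-mono-≤ h₃ (+-mono-≤ h₄ (+-mono-≤ h₅ (+-mono-≤ h₆ (+-mono-≤ h₇ (+-mono-≤ h₈ h₉)))))))))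
  where
  balance : ∀ δ a b yR S L t ox ou ow uA wA uB wB →
    δ + (δ + (δ + ((uA + wA) + ((wB + uB) + ((ox + (ou + (ow + S))) + (L + (t + (((a + b) + yR) + 5)))))))) ≡
    suc ((t + ox) + (((uA + uB) + ou) + (((wA + wB) + ow) + (suc a + (suc b + (yR + (S + ((2 + L) + 3 * δ))))))))
  balance = solve-∀

-- Here `t` stands for the number of neighbours of `x` on the cycle minus two, and each of at least
-- `1 + t` successors has at least `2 + s` neighbours off it. The sum of the hypotheses is then
-- violated by `1 + s * t`.
crossed-arith : ∀ {δ k s t ox cv ov S yR} → δ ≤ k + (2 + s) →
  δ ≤ (2 + t) + ox → δ ≤ cv + ov → cv ≤ 2 + t → (2 + s) * (1 + t) ≤ S → ox + (ov + S) ≤ yR →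
  (k + yR) + 5 ≤ 3 * δ → ⊥
crossed-arith {δ} {k} {s} {t} {ox} {cv} {ov} {S} {yR} h₁ h₂ h₃ h₄ h₅ h₆ h₇ =
  m+1+n≰m _ (≤-trans (≤-reflexive (sym (balance δ k s t ox cv ov S yR)))
    (+-mono-≤ h₁ (+-mono-≤ h₂ (+-mono-≤ h₃ (+-mono-≤ h₄ (+-mono-≤ h₅ (+-mono-≤ h₆ h₇)))))))
  where
  balance : ∀ δ k s t ox cv ov S yR →
    δ + (δ + (δ + (cv + ((2 + s) * (1 + t) + ((ox + (ov + S)) + ((k + yR) + 5)))))) ≡
    ((k + (2 + s)) + (((2 + t) + ox) + ((cv + ov) + ((2 + t) + (S + (yR + 3 * δ)))))) + suc (s * t)
  balance = solve-∀

-- Again the violation is by one: the bound `tx ≤ 1` makes up for the one shared vertex allowed by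
-- `suc yR`.
ear-arith : ∀ {δ a b yR tx ox ou ow uA wA uB wB} →
  δ ≤ tx + ox → δ ≤ (uA + uB) + ou → δ ≤ (wA + wB) + ow →
  tx ≤ 1 → uA + wA ≤ suc a → wB + uB ≤ suc b → ox + (ou + ow) ≤ suc yR →
  ((a + b) + yR) + 5 ≤ 3 * δ → ⊥
ear-arith {δ} {a} {b} {yR} {tx} {ox} {ou} {ow} {uA} {wA} {uB} {wB} h₁ h₂ h₃ h₄ h₅ h₆ h₇ h₈ =
  1+n≰n (≤-trans (≤-reflexive (sym (balance δ a b yR tx ox ou ow uA wA uB wB)))
    (+-mono-≤ h₁ (+-mono-≤ h₂ (+-mono-≤ h₃ (+-mono-≤ h₄ (+-mono-≤ h₅ (+-mono-≤ h₆ (+-mono-≤ h₇ h₈))))))))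
  where
  balance : ∀ δ a b yR tx ox ou ow uA wA uB wB →
    δ + (δ + (δ + (tx + ((uA + wA) + ((wB + uB) + ((ox + (ou + ow)) + (((a + b) + yR) + 5))))))) ≡
    suc ((tx + ox) + (((uA + uB) + ou) + (((wA + wB) + ow) + (1 + (suc a + (suc b + (suc yR + 3 * δ)))))))
  balance = solve-∀

-- Paths and cycles in a bipartite graph

module BipartiteGraph {N : ℕ} (G : Graph N) (X Y : Subset N) (bip : Bipartition G X Y) where

  open Bipartition bip
  open DecMembership (Fin._≟_ {N}) using () renaming (_∈?_ to _∈ₗ?_) public

  infix 4 _∼_
  infix 5 _,_∙_

  V : Set
  V = Fin N

  _∼_ : V → V → Set
  u ∼ v = Adjacent G u v

  ∼-sym : ∀ {u v} → u ∼ v → v ∼ u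
  ∼-sym = symmetric G

  X⊎Y : ∀ v → v ∈ X ⊎ v ∈ Y
  X⊎Y v = x∈p∪q⁻ X Y (subst (v ∈_) (sym covering) ∈⊤)

  X∌Y : ∀ {v} → v ∈ X → v ∉ Y
  X∌Y v∈X v∈Y = disjoint (_ , x∈p∩q⁺ (v∈X , v∈Y))

  X→Y : ∀ {u v} → u ∈ X → u ∼ v → v ∈ Y
  X→Y {v = v} u∈X u∼v with X⊎Y v
  ... | inj₁ v∈X = ⊥-elim (independentˡ u∈X v∈X u∼v)
  ... | inj₂ v∈Y = v∈Y

  Y→X : ∀ {u v} → u ∈ Y → u ∼ v → v ∈ X
  Y→X {v = v} u∈Y u∼v with X⊎Y v
  ... | inj₁ v∈X = v∈X
  ... | inj₂ v∈Y = ⊥-elim (independentʳ u∈Y v∈Y u∼v)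

  X≁X : ∀ {u v} → u ∈ X → v ∈ X → v ∉ neighbours G u
  X≁X u∈X v∈X = independentˡ u∈X v∈X

  X≢Y : ∀ {u v} → u ∈ X → v ∈ Y → u ≢ v
  X≢Y u∈X v∈Y refl = X∌Y u∈X v∈Y

  -- A cycle is represented by `Path a l b` with `b ∼ a` and `Unique l`. A single edge thus counts
  -- as a cycle on two vertices, from which the search for longer cycles can start.
  data Path : V → List V → V → Set where
    [_] : ∀ a → Path a (a ∷ []) a
    _∷_ : ∀ {a b l c} → a ∼ b → Path b l c → Path a (a ∷ l) c

  _,_∙_ : ∀ {a p b c q d} → Path a p b → b ∼ c → Path c q d → Path a (p ++ q) d
  [ _ ]   , e ∙ q = e ∷ q
  (f ∷ p) , e ∙ q = f ∷ (p , e ∙ q)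

  recast : ∀ {a k l b} → k ≡ l → Path a k b → Path a l b
  recast refl p = p

  rev : ∀ {a p b} → Path a p b → Path b (reverse p) a
  rev [ a ] = [ a ]
  rev {a} (_∷_ {l = l} e p) rewrite unfold-reverse a l = rev p , ∼-sym e ∙ [ a ]

  path-head : ∀ {a l b} → Path a l b → ∃[ r ] l ≡ a ∷ r
  path-head [ _ ]   = [] , refl
  path-head (_ ∷ _) = _ , refl

  start≡ : ∀ {a b l c} → Path a (b ∷ l) c → a ≡ b
  start≡ [ _ ]   = refl
  start≡ (_ ∷ _) = refl

  start∈ : ∀ {a l b} → Path a l b → a ∈ₗ l
  start∈ [ _ ]   = here refl
  start∈ (_ ∷ _) = here refl

  end∈ : ∀ {a l b} → Path a l b → b ∈ₗ l
  end∈ [ _ ]   = here refl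
  end∈ (_ ∷ p) = there (end∈ p)

  end≡ : ∀ {a l b a′ b′} → Path a l b → Path a′ l b′ → b ≡ b′
  end≡ [ _ ]   [ _ ]   = refl
  end≡ [ _ ]   (_ ∷ ())
  end≡ (_ ∷ ()) [ _ ]
  end≡ (_ ∷ p) (_ ∷ q) = end≡ p q

  split : ∀ {a s} p {c q b} → Path a (s ∷ p ++ c ∷ q) b →
    ∃[ m ] (Path a (s ∷ p) m × m ∼ c × Path c (c ∷ q) b)
  split [] (e ∷ p) with refl ← start≡ p = _ , [ _ ] , e , p
  split (t ∷ p) (e ∷ r) with refl ← start≡ r with split p r
  ... | m , r₁ , f , r₂ = m , e ∷ r₁ , f , r₂

  suffix : ∀ {a} p {c q b} → Path a (p ++ c ∷ q) b → Path c (c ∷ q) b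
  suffix []      r with refl ← start≡ r = r
  suffix (_ ∷ p) r = proj₂ (proj₂ (proj₂ (split p r)))

  split-edge : ∀ {a} p {v c q b} → Path a (p ++ v ∷ c ∷ q) b →
    Path a (p ++ v ∷ []) v × v ∼ c × Path c (c ∷ q) b
  split-edge []      r with refl ← start≡ r with _ , [ _ ] , e , r′ ← split [] r = [ _ ] , e , r′
  split-edge (s ∷ p) {v} {c} {q} r
    with m , r₁ , e , r₂ ← split (p ++ v ∷ []) (recast (cong (s ∷_) (sym (++-assoc p (v ∷ []) (c ∷ q)))) r)
    with refl ← end≡ [ v ] (suffix (s ∷ p) r₁) = r₁ , e , r₂

  rotate : ∀ {a} p {c q b} → Path a (p ++ c ∷ q) b → b ∼ a →
    ∃[ m ] (Path c (c ∷ q ++ p) m × m ∼ c)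
  rotate [] {q = q} r e with refl ← start≡ r = _ , recast (cong (_ ∷_) (sym (++-identityʳ q))) r , e
  rotate (_ ∷ p) r e with m , r₁ , f , r₂ ← split p r = m , (r₂ , e ∙ r₁) , f

  -- This lets the listing of a cycle end at a chosen vertex, such as a neighbour of an outside
  -- vertex or an end of an ear; the head of the list is then its successor.
  rotate-to-end : ∀ {a l b y} → Path a l b → b ∼ a → y ∈ₗ l →
    ∃[ c ] ∃[ k ] (k ↭ l × Path c k y × y ∼ c)
  rotate-to-end {y = y} r e y∈l with ∈-∃++ y∈l
  ... | p , [] , refl with refl ← end≡ [ y ] (suffix p r) = _ , _ , ↭-refl , r , e
  ... | p , c ∷ q , refl
    with m , r′ , m∼c ← rotate (p ++ y ∷ []) (recast (sym (++-assoc p (y ∷ []) (c ∷ q))) r) e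
    with refl ← end≡ [ y ] (suffix (c ∷ q ++ p) (recast (sym (++-assoc (c ∷ q) p (y ∷ []))) r′)) =
    c , _ , rearrange (# 0F ⊕ # 1F ⊕ # 2F) (# 1F ⊕ # 2F ⊕ # 0F) refl ((c ∷ q) ∷ p ∷ (y ∷ []) ∷ []) , r′ , m∼c

  simplify : ∀ {a l b} → Path a l b →
    ∃[ k ] (Path a k b × Unique k × (∀ {v} → v ∈ₗ k → v ∈ₗ l))
  simplify [ a ] = _ , [ a ] , [] ∷ [] , id
  simplify {a} (e ∷ p) with k , q , uk , k⊆l ← simplify p with a ∈ₗ? k
  ... | no  a∉k = _ , e ∷ q , ∉⇒All≢ a∉k ∷ uk , λ { (here refl) → here refl ; (there v∈k) → there (k⊆l v∈k) }
  ... | yes a∈k with k₁ , k₂ , refl ← ∈-∃++ a∈k =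
    _ , suffix k₁ q , Unique-++⁻ʳ k₁ uk , there ∘ k⊆l ∘ ∈-++⁺ʳ k₁

  balanced-XY : ∀ {a l b} → Path a l b → a ∈ X → b ∈ Y → cnt X l ≡ cnt Y l
  balanced-XY [ _ ] a∈X a∈Y = ⊥-elim (X∌Y a∈X a∈Y)
  balanced-XY (e ∷ [ b ]) a∈X b∈Y
    rewrite χ-∈ a∈X | χ-∈ b∈Y | χ-∉ (X∌Y a∈X) | χ-∉ {S = X} (λ b∈X → X∌Y b∈X b∈Y) = refl
  balanced-XY (e ∷ (f ∷ p)) a∈X b∈Y with y∈Y ← X→Y a∈X e
    rewrite χ-∈ a∈X | χ-∈ y∈Y | χ-∉ (X∌Y a∈X) | χ-∉ {S = X} (λ y∈X → X∌Y y∈X y∈Y) =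
    cong suc (balanced-XY p (Y→X y∈Y f) b∈Y)

  -- The closing edge puts the two ends in different classes, so the alternation of X and Y pairs
  -- off the vertices. A listing that starts in Y is reversed first.
  balanced : ∀ {a l b} → Path a l b → b ∼ a → cnt X l ≡ cnt Y l
  balanced {a} {l} p e with X⊎Y a
  ... | inj₁ a∈X = balanced-XY p a∈X (X→Y a∈X (∼-sym e))
  ... | inj₂ a∈Y =
    ≡-trans (sym (cnt-↭ X (↭-reverse l))) (≡-trans (balanced-XY (rev p) (Y→X a∈Y (∼-sym e)) a∈Y) (cnt-↭ Y (↭-reverse l)))

  χX+χY≡1 : ∀ v → χ X v + χ Y v ≡ 1
  χX+χY≡1 v with X⊎Y v
  ... | inj₁ v∈X rewrite χ-∈ v∈X | χ-∉ (X∌Y v∈X) = refl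
  ... | inj₂ v∈Y rewrite χ-∈ v∈Y | χ-∉ {S = X} (λ v∈X → X∌Y v∈X v∈Y) = refl

  length≡cnt : ∀ l → length l ≡ cnt X l + cnt Y l
  length≡cnt []      = refl
  length≡cnt (v ∷ l) = ≡-trans (cong₂ _+_ (sym (χX+χY≡1 v)) (length≡cnt l)) (swap-middle (χ X v) (χ Y v) (cnt X l) (cnt Y l))
    where
    swap-middle : ∀ a b c d → (a + b) + (c + d) ≡ (a + c) + (b + d)
    swap-middle = solve-∀

  -- Successors and crossings

  succs : Subset N → List V → List V
  succs S []          = []
  succs S (a ∷ [])    = []
  succs S (a ∷ b ∷ l) = if lookup S a then b ∷ succs S (b ∷ l) else succs S (b ∷ l)

  -- `succs` reads the list linearly, so the last vertex `b` contributes no successor; the term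
  -- `χ S b` makes up for it.
  length-succs : ∀ S {a l b} → Path a l b → length (succs S l) + χ S b ≡ cnt S l
  length-succs S [ a ] = sym (+-identityʳ (χ S a))
  length-succs S {a} (e ∷ p) with r , refl ← path-head p with lookup S a
  ... | true  = cong suc (length-succs S p)
  ... | false = length-succs S p

  succs⊆tail : ∀ S a l {c} → c ∈ₗ succs S (a ∷ l) → c ∈ₗ l
  succs⊆tail S a (b ∷ l) c∈ with lookup S a | c∈
  ... | true  | here refl = here refl
  ... | true  | there c∈′ = there (succs⊆tail S b l c∈′)
  ... | false | c∈′       = there (succs⊆tail S b l c∈′)

  succs-unique : ∀ S {l} → Unique l → Unique (succs S l)
  succs-unique S {[]}        u = []
  succs-unique S {a ∷ []}    u = []
  succs-unique S {a ∷ b ∷ l} (_ ∷ b∉l ∷ u) with lookup S a | succs-unique S {b ∷ l} (b∉l ∷ u)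
  ... | true  | ih = ∉⇒All≢ (All≢⇒∉ b∉l ∘ succs⊆tail S b l) ∷ ih
  ... | false | ih = ih

  ∈-succs : ∀ S {a l b c} → Path a l b → c ∈ₗ succs S l →
    ∃[ p ] ∃[ q ] ∃[ m ] (l ≡ p ++ c ∷ q × Path a p m × m ∈ S × m ∼ c × Path c (c ∷ q) b)
  ∈-succs S {a} (e ∷ p) c∈ with r , refl ← path-head p with lookup S a in eq | c∈
  ... | true  | here refl = a ∷ [] , r , a , refl , [ a ] , lookup⇒[]= a S eq , e , p
  ... | true  | there c∈′ with p₁ , q , m , l≡ , p₁-path , m∈S , m∼c , q-path ← ∈-succs S p c∈′ =
    a ∷ p₁ , q , m , cong (a ∷_) l≡ , e ∷ p₁-path , m∈S , m∼c , q-path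
  ∈-succs S {a} (e ∷ p) c∈ | false | c∈′ with p₁ , q , m , l≡ , p₁-path , m∈S , m∼c , q-path ← ∈-succs S p c∈′ =
    a ∷ p₁ , q , m , cong (a ∷_) l≡ , e ∷ p₁-path , m∈S , m∼c , q-path

  -- If l runs from u to y₃ and continues at w, then u ⋯ y w ⋯ and y₃ ⋯ y′ u
  -- bypass v.
  record Crossing (u w a : V) (l : List V) (b : V) : Set where
    constructor crossed
    field
      {y v y′} : V
      {p q}    : List V
      l≡       : l ≡ p ++ v ∷ q
      v∈X      : v ∈ X
      before   : Path a p y
      y∼v      : y ∼ v
      v∼y′     : v ∼ y′
      after    : Path y′ q b
      w∼y      : w ∼ y
      u∼y′     : u ∼ y′

  private
    no-crossing-step : ∀ {s t s′ t′ x} → s + t ≤ 1 → s′ + t′ ≤ x → (s + s′) + (t + t′) ≤ suc x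
    no-crossing-step {s} {t} {s′} {t′} h h′ = ≤-trans (≤-reflexive (sym (reorder s t s′ t′))) (+-mono-≤ h h′)
      where
      reorder : ∀ s t s′ t′ → (s + t) + (s′ + t′) ≡ (s + s′) + (t + t′)
      reorder = solve-∀

  -- Without a crossing at `v`, the vertex before `v` as a neighbour of `w` and the vertex after `v`
  -- as a neighbour of `u` contribute at most one together. For these pairs to tile the count, the
  -- first vertex of Y must be left out for `u`, which is what `drop 2` does; `crossing-or-few` puts
  -- it back at the cost of one.
  crossing-or-few′ : ∀ {u w a l b} → u ∈ X → w ∈ X → Path a l b → a ∈ X → b ∈ Y →
    Crossing u w a l b ⊎
    cnt (neighbours G w) l + cnt (neighbours G u) (drop 2 l) ≤ cnt X l
  crossing-or-few′ u∈X w∈X [ _ ] a∈X a∈Y = ⊥-elim (X∌Y a∈X a∈Y)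
  crossing-or-few′ {w = w} {b = b} u∈X w∈X (e ∷ [ _ ]) a∈X b∈Y
    rewrite χ-∉ (X≁X w∈X a∈X) | χ-∈ a∈X | χ-∉ {S = X} (λ b∈X → X∌Y b∈X b∈Y)
          | +-identityʳ (χ (neighbours G w) b) | +-identityʳ (χ (neighbours G w) b) = inj₂ (χ≤1 (neighbours G w) b)
  crossing-or-few′ u∈X w∈X (e ∷ (f ∷ [ _ ])) a∈X v∈Y = ⊥-elim (X∌Y (Y→X (X→Y a∈X e) f) v∈Y)
  crossing-or-few′ {u} {w} u∈X w∈X (_∷_ {a} {y} e (_∷_ {b = v} f p@(_∷_ {b = y′} g p′))) a∈X b∈Y
    with crossing-or-few′ u∈X w∈X p (Y→X (X→Y a∈X e) f) b∈Y | path-head p′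
  ... | inj₁ (crossed l≡ v′∈X before y∼v v∼y′ after w∼y u∼y′) | _ =
    inj₁ (crossed (cong (λ l → a ∷ y ∷ l) l≡) v′∈X (e ∷ (f ∷ before)) y∼v v∼y′ after w∼y u∼y′)
  ... | inj₂ few | r , refl with y∈Y ← X→Y a∈X e with v∈X ← Y→X y∈Y f
    rewrite χ-∉ (X≁X w∈X a∈X) | χ-∈ a∈X | χ-∉ {S = X} (λ y∈X → X∌Y y∈X y∈Y) | χ-∉ (X≁X u∈X v∈X)
    with (y ∈? neighbours G w) ×-dec (y′ ∈? neighbours G u)
  ... | yes (w∼y , u∼y′) = inj₁ (crossed {p = a ∷ y ∷ []} refl v∈X (e ∷ [ y ]) f g p′ w∼y u∼y′)
  ... | no  not-both     = inj₂ (no-crossing-step {χ (neighbours G w) y} (χ+χ≤1 not-both) few)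

  crossing-or-few : ∀ {u w a l b} → u ∈ X → w ∈ X → Path a l b → a ∈ X → b ∈ Y →
    Crossing u w a l b ⊎
    cnt (neighbours G u) l + cnt (neighbours G w) l ≤ suc (cnt X l)
  crossing-or-few u∈X w∈X p a∈X b∈Y with crossing-or-few′ u∈X w∈X p a∈X b∈Y
  ... | inj₁ c = inj₁ c
  crossing-or-few u∈X w∈X [ _ ] a∈X a∈Y | inj₂ few = ⊥-elim (X∌Y a∈X a∈Y)
  crossing-or-few {u} {w} u∈X w∈X (_∷_ {b = y} e p) a∈X b∈Y | inj₂ few with r , refl ← path-head p
    rewrite χ-∉ (X≁X u∈X a∈X) = inj₂ (≤-trans (≤-reflexive (reorder (χ (neighbours G u) y) _ _)) (+-mono-≤ (χ≤1 (neighbours G u) y) few))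
    where
    reorder : ∀ a b c → (a + b) + c ≡ a + (c + b)
    reorder = solve-∀

  -- Vertices off a cycle and disjoint neighbourhoods

  off-part : ∀ {l} → Unique l → ∃[ R ] ((∀ S → ∣ S ∣ ≡ cnt S l + cnt S R) × Unique R ×
    (∀ {z} → z ∈ₗ R → z ∉ₗ l) × (∀ {z} → z ∉ₗ l → z ∈ₗ R))
  off-part {l} l-unique with R , l++R↭ ← complement l-unique (λ {v} _ → ∈-allFin v) =
    R , (λ S → ≡-trans (cnt-allFin S) (≡-trans (sym (cnt-↭ S l++R↭)) (cnt-++ S l R))) ,
    Unique-++⁻ʳ l l++R-unique ,
    (λ z∈R z∈l → Unique-disjoint l l++R-unique z∈l z∈R) ,
    λ {z} z∉l → other z∉l (∈-++⁻ l (∈-resp-↭ (↭-sym l++R↭) (∈-allFin z)))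
    where
    l++R-unique = Unique-resp-↭ (↭-sym l++R↭) (allFin⁺ N)
    other : ∀ {z} → z ∉ₗ l → z ∈ₗ l ⊎ z ∈ₗ R → z ∈ₗ R
    other z∉l (inj₁ z∈l) = ⊥-elim (z∉l z∈l)
    other z∉l (inj₂ z∈R) = z∈R

  Apart : List V → V → V → Set
  Apart R v w = ∀ z → z ∈ₗ R → v ∼ z → w ∼ z → ⊥

  degree-sum : List V → List V → ℕ
  degree-sum R F = sum (map (λ v → cnt (neighbours G v) R) F)

  -- Double counting, one vertex `z` of `R` at a time: at most one member of `F` is adjacent to `z`,
  -- and only if `z` lies in Y.
  apart-bound : ∀ R {F} → AllPairs (Apart R) F → (∀ {v} → v ∈ₗ F → v ∈ X) → degree-sum R F ≤ cnt Y R
  apart-bound [] {F} _ _ = ≤-reflexive (zeros F)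
    where
    zeros : ∀ F → degree-sum [] F ≡ 0
    zeros []      = refl
    zeros (v ∷ F) = zeros F
  apart-bound (z ∷ R) {F} apart F⊆X =
    ≤-trans (≤-reflexive (unzip F)) (+-mono-≤ (at-z F apart F⊆X) (apart-bound R (weaken apart) F⊆X))
    where
    at : List V → ℕ
    at F = sum (map (λ v → χ (neighbours G v) z) F)

    unzip : ∀ F → degree-sum (z ∷ R) F ≡ at F + degree-sum R F
    unzip []      = refl
    unzip (v ∷ F) = ≡-trans (cong (cnt (neighbours G v) (z ∷ R) +_) (unzip F))
      (interchange (χ (neighbours G v) z) (cnt (neighbours G v) R) (at F) (degree-sum R F))
      where
      interchange : ∀ a b c d → (a + b) + (c + d) ≡ (a + c) + (b + d)
      interchange = solve-∀

    none : ∀ F → All (λ w → ¬ w ∼ z) F → at F ≡ 0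
    none []      []         = refl
    none (v ∷ F) (v≁z ∷ ps) = cong₂ _+_ (χ-∉ v≁z) (none F ps)

    at-z : ∀ F → AllPairs (Apart (z ∷ R)) F → (∀ {v} → v ∈ₗ F → v ∈ X) → at F ≤ χ Y z
    at-z []      _        _ = z≤n
    at-z (v ∷ F) (p ∷ ps) F⊆X with z ∈? neighbours G v
    ... | no  v≁z rewrite χ-∉ v≁z = at-z F ps (F⊆X ∘ there)
    ... | yes v∼z rewrite χ-∈ v∼z | none F (All.map (λ apart → apart z (here refl) v∼z) p)
                        | χ-∈ (X→Y (F⊆X (here refl)) v∼z) = ≤-refl

    weaken : ∀ {F} → AllPairs (Apart (z ∷ R)) F → AllPairs (Apart R) F
    weaken = AllPairs.map (λ apart w → apart w ∘ there)

  degree-sum-lower : ∀ s R F → (∀ {v} → v ∈ₗ F → s ≤ cnt (neighbours G v) R) → s * length F ≤ degree-sum R F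
  degree-sum-lower s R []      _ = ≤-reflexive (*-zeroʳ s)
  degree-sum-lower s R (v ∷ F) h =
    ≤-trans (≤-reflexive (*-suc s (length F))) (+-mono-≤ (h (here refl)) (degree-sum-lower s R F (h ∘ there)))

  unique⇒AllPairs : ∀ {Q : V → V → Set} {F} → Unique F →
    (∀ {v w} → v ∈ₗ F → w ∈ₗ F → v ≢ w → Q v w) → AllPairs Q F
  unique⇒AllPairs []       _ = []
  unique⇒AllPairs (p ∷ ps) h =
    All.tabulate (λ w∈F → h (here refl) (there w∈F) (All.lookup p w∈F)) ∷
    unique⇒AllPairs ps (λ v∈F w∈F → h (there v∈F) (there w∈F))

  -- The vertex `v` may or may not occur in `F`, hence an inequality for the lengths. A crossing
  -- vertex, for instance, is in X but may or may not be a successor.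
  remove : ∀ v {F : List V} → Unique F →
    ∃[ F′ ] (Unique F′ × (∀ {w} → w ∈ₗ F′ → w ∈ₗ F × w ≢ v) × length F ≤ suc (length F′))
  remove v []                         = [] , [] , (λ ()) , z≤n
  remove v {w ∷ F} (p ∷ ps) with v Fin.≟ w
  ... | yes refl = F , ps , (λ w∈F → there w∈F , λ { refl → All≢⇒∉ p w∈F }) , ≤-refl
  ... | no  v≢w with F′ , u , F′⊆ , len ← remove v ps =
    w ∷ F′ , ∉⇒All≢ (λ w∈F′ → All≢⇒∉ p (proj₁ (F′⊆ w∈F′))) ∷ u ,
    (λ { (here refl) → here refl , v≢w ∘ sym ; (there w∈) → there (proj₁ (F′⊆ w∈)) , proj₂ (F′⊆ w∈) }) ,
    s≤s len

  triple-apart : ∀ R {x u w} → x ∈ X → u ∈ X → w ∈ X → Apart R u w → Apart R x u → Apart R x w →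
    cnt (neighbours G x) R + (cnt (neighbours G u) R + cnt (neighbours G w) R) ≤ cnt Y R
  triple-apart R {x} {u} {w} x∈X u∈X w∈X uw xu xw =
    ≤-trans (≤-reflexive (cong (λ c → cnt (neighbours G x) R + (cnt (neighbours G u) R + c)) (sym (+-identityʳ (cnt (neighbours G w) R)))))
      (apart-bound R ((xu ∷ xw ∷ []) ∷ (uw ∷ []) ∷ [] ∷ [])
        λ { (here refl) → x∈X ; (there (here refl)) → u∈X ; (there (there (here refl))) → w∈X })

  -- Only `e` can be counted more than once, and at most twice since `u` and `w` do not share it. It
  -- is split off, and `triple-apart` handles the rest of `R`.
  triple-bound : ∀ {R} e {x u w} → Unique R → x ∈ X → u ∈ X → w ∈ X → Apart R u w →
    (∀ {z} → z ∈ₗ R → z ≢ e → x ∼ z → u ∼ z → ⊥) → (∀ {z} → z ∈ₗ R → z ≢ e → x ∼ z → w ∼ z → ⊥) →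
    cnt (neighbours G x) R + (cnt (neighbours G u) R + cnt (neighbours G w) R) ≤ suc (cnt Y R)
  triple-bound {R} e {x} {u} {w} R-unique x∈X u∈X w∈X uw xu xw with e ∈ₗ? R
  ... | no e∉R = m≤n⇒m≤1+n (triple-apart R x∈X u∈X w∈X uw
    (λ z z∈R → xu z∈R λ { refl → e∉R z∈R }) (λ z z∈R → xw z∈R λ { refl → e∉R z∈R }))
  ... | yes e∈R with R₁ , R₂ , refl ← ∈-∃++ e∈R = subst₂ _≤_
    (cong₂ _+_ (same (neighbours G x)) (cong₂ _+_ (same (neighbours G u)) (same (neighbours G w)))) (cong suc (same Y))
    (≤-trans (≤-reflexive (regroup (χ (neighbours G x) e) (cnt (neighbours G x) R′)
        (χ (neighbours G u) e) (cnt (neighbours G u) R′) (χ (neighbours G w) e) (cnt (neighbours G w) R′)))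
      (+-mono-≤ at-e (triple-apart R′ x∈X u∈X w∈X (λ z z∈ → uw z (R′⊆R z∈))
        (λ z z∈ → xu (R′⊆R z∈) (≢e z∈)) (λ z z∈ → xw (R′⊆R z∈) (≢e z∈)))))
    where
    R′ : List V
    R′ = R₁ ++ R₂
    e∷R′↭R : e ∷ R′ ↭ R₁ ++ e ∷ R₂
    e∷R′↭R = ↭-sym (shift e R₁ R₂)
    same : ∀ S → cnt S (e ∷ R′) ≡ cnt S (R₁ ++ e ∷ R₂)
    same S = cnt-↭ S e∷R′↭R
    R′⊆R : ∀ {z} → z ∈ₗ R′ → z ∈ₗ R₁ ++ e ∷ R₂
    R′⊆R z∈ = ∈-resp-↭ e∷R′↭R (there z∈)
    ≢e : ∀ {z} → z ∈ₗ R′ → z ≢ e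
    ≢e z∈ refl = Unique-disjoint (e ∷ []) (Unique-resp-↭ (shift e R₁ R₂) R-unique) (here refl) z∈
    regroup : ∀ a b c d f g → (a + b) + ((c + d) + (f + g)) ≡ (a + (c + f)) + (b + (d + g))
    regroup = solve-∀
    uw-at-e : χ (neighbours G u) e + χ (neighbours G w) e ≤ 1
    uw-at-e = χ+χ≤1 λ { (u∼e , w∼e) → uw e e∈R u∼e w∼e }
    at-e : χ (neighbours G x) e + (χ (neighbours G u) e + χ (neighbours G w) e) ≤ suc (χ Y e)
    at-e with e ∈? neighbours G x
    ... | yes x∼e rewrite χ-∈ x∼e | χ-∈ (X→Y x∈X x∼e) = s≤s uw-at-e
    ... | no  x≁e rewrite χ-∉ x≁e = ≤-trans uw-at-e (s≤s z≤n)

  -- Rerouting a longest cycle through one outside vertex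

  module LongestCycles (k : ℕ)
    (longest : ∀ {a l b} → Path a l b → b ∼ a → Unique l → cnt X l ≤ k)
    where

    off-edge-unique : ∀ {x z : V} {l} → x ≢ z → x ∉ₗ l → z ∉ₗ l → Unique l → Unique (x ∷ z ∷ l)
    off-edge-unique x≢z x∉l z∉l l-unique =
      (x≢z ∷ ∉⇒All≢ x∉l) ∷ ∉⇒All≢ z∉l ∷ l-unique

    -- A successor of a neighbour of x on the cycle l.
    record Succ (l : List V) (x c : V) : Set where
      constructor succ
      field
        {p q} : List V
        {y}   : V
        l≡    : l ≡ p ++ c ∷ q
        path  : Path c (c ∷ q ++ p) y
        y∼c   : y ∼ c
        x∼y   : x ∼ y

      cyclic : c ∷ q ++ p ↭ l
      cyclic = ↭-trans (↭-++-comm (c ∷ q) p) (↭-reflexive (sym l≡))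

      succ∈X : x ∈ X → c ∈ X
      succ∈X x∈X = Y→X (X→Y x∈X x∼y) y∼c

    open Succ

    all-succs : ∀ {u l y x} → Path u l y → y ∼ u → x ∼ y → Unique l →
      ∃[ U ] (Unique U × length U ≡ cnt (neighbours G x) l × (∀ {c} → c ∈ₗ U → Succ l x c))
    all-succs {u} {l} {y} {x} r e x∼y l-unique with l′ , refl ← path-head r =
      -- The head `u` follows the last vertex `y`, a neighbour of `x` whose successor `succs`
      -- misses.
      u ∷ succs S l ,
      ∉⇒All≢ (λ u∈ → Unique-disjoint (u ∷ []) l-unique (here refl) (succs⊆tail S u l′ u∈)) ∷ succs-unique S l-unique ,
      ≡-trans (+-comm 1 (length (succs S l))) (≡-trans (cong (length (succs S l) +_) (sym (χ-∈ x∼y))) (length-succs S r)) ,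
      λ { (here refl) → succ {p = []} refl (recast (cong (u ∷_) (sym (++-identityʳ l′))) r) e x∼y
        ; (there c∈) → later c∈ }
      where
      S = neighbours G x
      later : ∀ {c} → c ∈ₗ succs S l → Succ l x c
      later c∈ with p , q , m , l≡ , p-path , x∼m , m∼c , q-path ← ∈-succs S r c∈ =
        succ l≡ (q-path , e ∙ p-path) m∼c x∼m

    module Inserting {l : List V} (l-unique : Unique l) (l-count : cnt X l ≡ k)
      {x : V} (x∈X : x ∈ X) (x∉l : x ∉ₗ l) where

      -- The vertex `x` alone raises the count above `k`; `z` serves to close the rerouted cycle.
      too-long : ∀ {z a c b} → z ∉ₗ l → x ≢ z → Path a c b → b ∼ a → c ↭ x ∷ z ∷ l → ⊥
      too-long {z} {c = c} z∉l x≢z c-path b∼a c↭ = <⇒≱ k<cnt (longest c-path b∼a c-unique)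
        where
        c-unique : Unique c
        c-unique = Unique-resp-↭ (↭-sym c↭) (off-edge-unique x≢z x∉l z∉l l-unique)
        k<cnt : k < cnt X c
        k<cnt rewrite cnt-↭ X c↭ | χ-∈ x∈X | l-count = s≤s (m≤n+m k (χ X z))

      -- The longer cycle is c ⋯ y x z.
      insert-at-end : ∀ {z c p y} → p ↭ l → Path c p y → x ∼ y → x ∼ z → z ∼ c → z ∉ₗ l → ⊥
      insert-at-end {z} {p = p} p↭l r x∼y x∼z z∼c z∉l =
        too-long z∉l (X≢Y x∈X (X→Y x∈X x∼z)) (r , ∼-sym x∼y ∙ ([ x ] , x∼z ∙ [ z ])) z∼c
          (↭-trans (↭-++-comm p (x ∷ z ∷ [])) (prep x (prep z p↭l)))

      -- The longer cycle is v ⋯ c y′ ⋯ y x z.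
      insert-over-chord : ∀ {z c p v y′ q y} → p ++ q ↭ l → Path c p v → Path y′ q y →
        x ∼ y → c ∼ y′ → v ∼ z → x ∼ z → z ∉ₗ l → ⊥
      insert-over-chord {z} {p = p} {q = q} pq↭l rp rq x∼y c∼y′ v∼z x∼z z∉l =
        too-long z∉l (X≢Y x∈X (X→Y x∈X x∼z)) (rev rp , c∼y′ ∙ (rq , ∼-sym x∼y ∙ ([ x ] , x∼z ∙ [ z ]))) (∼-sym v∼z)
          (↭-trans (rearrange (↶ # 0F ⊕ # 1F ⊕ # 2F) (# 2F ⊕ # 0F ⊕ # 1F) refl (p ∷ q ∷ (x ∷ z ∷ []) ∷ []))
            (prep x (prep z pq↭l)))

      -- The longer cycle is x y′ ⋯ u z w ⋯ y.
      insert-between-arcs : ∀ {z u A y′ w B y} → A ++ B ↭ l → Path u A y′ → Path w B y →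
        x ∼ y′ → x ∼ y → u ∼ z → w ∼ z → x ≢ z → z ∉ₗ l → ⊥
      insert-between-arcs {z} {A = A} {B = B} AB↭l rA rB x∼y′ x∼y u∼z w∼z x≢z z∉l =
        too-long z∉l x≢z ([ x ] , x∼y′ ∙ (rev rA , u∼z ∙ ([ z ] , ∼-sym w∼z ∙ rB))) (∼-sym x∼y)
          (↭-trans (rearrange (# 0F ⊕ ↶ # 2F ⊕ # 1F ⊕ # 3F) (# 0F ⊕ # 1F ⊕ # 2F ⊕ # 3F) refl
                     ((x ∷ []) ∷ (z ∷ []) ∷ A ∷ B ∷ []))
            (prep x (prep z AB↭l)))

      succ-apart : ∀ {z c} → Succ l x c → x ∼ z → z ∼ c → z ∉ₗ l → ⊥
      succ-apart s x∼z z∼c z∉l = insert-at-end (cyclic s) (path s) (x∼y s) x∼z z∼c z∉l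

      -- Each given path runs around the whole cycle. Suffixes of them are the arcs c ⋯ y′ and c′ ⋯
      -- y, whose starts are joined through `z` and whose ends through `x`.
      succs-apart-ordered : ∀ {z c c′ y y′} p e q → p ++ (c ∷ e) ++ c′ ∷ q ≡ l →
        Path c ((c ∷ e ++ c′ ∷ q) ++ p) y → Path c′ (c′ ∷ q ++ (p ++ c ∷ e)) y′ →
        x ∼ y → x ∼ y′ → c ∼ z → c′ ∼ z → x ≢ z → z ∉ₗ l → ⊥
      succs-apart-ordered {c = c} {c′} p e q l≡ r r′ x∼y x∼y′ =
        insert-between-arcs (↭-trans (rearrange (# 0F ⊕ # 1F ⊕ # 2F) (# 2F ⊕ # 0F ⊕ # 1F) refl ((c ∷ e) ∷ (c′ ∷ q) ∷ p ∷ []))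
             (↭-reflexive l≡))
          (suffix (c′ ∷ q ++ p) (recast (sym (++-assoc (c′ ∷ q) p (c ∷ e))) r′))
          (suffix (c ∷ e) (recast (++-assoc (c ∷ e) (c′ ∷ q) p) r))
          x∼y′ x∼y

      succs-apart : ∀ {z c c′} → Succ l x c → Succ l x c′ → c ≢ c′ → c ∼ z → c′ ∼ z → x ≢ z → z ∉ₗ l → ⊥
      succs-apart {z} {c} {c′} (succ {p} {q} l≡ r _ x∼y) (succ {p′} {q′} l≡′ r′ _ x∼y′) c≢c′ c∼z c′∼z
        with compare-cuts p (c ∷ q) p′ (c′ ∷ q′) (≡-trans (sym l≡) l≡′)
      ... | inj₁ ([]    , _    , refl) = ⊥-elim (c≢c′ refl)
      ... | inj₁ (_ ∷ e , refl , refl) = succs-apart-ordered p e q′ (sym l≡) r r′ x∼y x∼y′ c∼z c′∼z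
      ... | inj₂ (_ , e , refl , refl) = succs-apart-ordered p′ e q (sym l≡′) r′ r x∼y′ x∼y c′∼z c∼z

      -- If c comes before v, the longer cycle is c ⋯ y₁ w ⋯ y x y₃ ⋯ y₂ v z;
      -- otherwise it is c ⋯ y₄ x y ⋯ y₂ u ⋯ y₁ v z.
      crossed-apart : ∀ {z u p y₁ v y₂ q y₃ w B y₄ c} → v ∈ X → l ≡ p ++ v ∷ q ++ B →
        Path u p y₁ → y₁ ∼ v → v ∼ y₂ → Path y₂ q y₃ → y₃ ∼ w → Path w B y₄ →
        w ∼ y₁ → u ∼ y₂ → x ∼ y₃ → x ∼ y₄ →
        Succ l x c → c ≢ v → v ∼ z → c ∼ z → x ≢ z → z ∉ₗ l → ⊥
      crossed-apart {z} {u} {p} {y₁} {v} {y₂} {q} {y₃} {w} {B} {y₄} {c} v∈X l≡ rp y₁∼v v∼y₂ rq y₃∼w rB w∼y₁ u∼y₂ x∼y₃ x∼y₄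
        s@(succ {p₁} {q₁} {y} l≡₁ r _ x∼y) c≢v v∼z c∼z x≢z z∉l
        with compare-cuts p₁ (c ∷ q₁) p (v ∷ q ++ B) (≡-trans (sym l≡₁) l≡)
      ... | inj₁ ([]    , _    , refl) = c≢v refl
      ... | inj₁ (_ ∷ e , refl , refl) with B′ , refl ← path-head rB =
        too-long z∉l x≢z
          (suffix p₁ rp , ∼-sym w∼y₁ ∙ (rBp , ∼-sym x∼y ∙ ([ x ] , x∼y₃ ∙ (rev rq , ∼-sym v∼y₂ ∙ ([ v ] , v∼z ∙ [ z ])))))
          (∼-sym c∼z)
          (↭-trans (rearrange (# 4F ⊕ (# 6F ⊕ # 3F) ⊕ # 0F ⊕ ↶ # 5F ⊕ # 2F ⊕ # 1F)
                              (# 0F ⊕ # 1F ⊕ (# 3F ⊕ # 4F) ⊕ # 2F ⊕ # 5F ⊕ # 6F) refl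
                     ((x ∷ []) ∷ (z ∷ []) ∷ (v ∷ []) ∷ p₁ ∷ (c ∷ e) ∷ q ∷ (w ∷ B′) ∷ []))
            (prep x (prep z (↭-reflexive (sym l≡)))))
        where
        rBp : Path w ((w ∷ B′) ++ p₁) y
        rBp = suffix (c ∷ e ++ v ∷ q) (recast (≡-trans (++-assoc (c ∷ e) (v ∷ q ++ w ∷ B′) p₁)
                (≡-trans (cong (λ k → c ∷ e ++ v ∷ k) (++-assoc q (w ∷ B′) p₁)) (sym (++-assoc (c ∷ e) (v ∷ q) (w ∷ B′ ++ p₁))))) r)
      -- Here `c` comes directly after `v`, so it equals `y₂` and lies in Y, whereas successors lie
      -- in X.
      ... | inj₂ (_ , [] , refl , eq) with q′ , refl ← path-head rq with refl , eq′ ← ∷-injective eq with refl , _ ← ∷-injective eq′ =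
        X∌Y (succ∈X s x∈X) (X→Y v∈X v∼y₂)
      -- The path from `y₂` to `y₄` is cut before `c`, on whichever side of `w` that is; `e₀ ∷ e` is
      -- the part from `y₂` to the predecessor of `c`.
      ... | inj₂ (_ , e₀ ∷ e , refl , eq) with q′ , refl ← path-head rq with refl , eq′ ← ∷-injective eq with refl , _ ← ∷-injective eq′ =
        too-long z∉l x≢z
          (suffix (e₀ ∷ e) (recast eq′ (rq , y₃∼w ∙ rB)) , ∼-sym x∼y₄ ∙ ([ x ] , x∼y ∙ (rev re , ∼-sym u∼y₂ ∙ (rp , y₁∼v ∙ ([ v ] , v∼z ∙ [ z ])))))
          (∼-sym c∼z)
          (↭-trans (rearrange (# 5F ⊕ # 0F ⊕ ↶ # 4F ⊕ # 3F ⊕ # 2F ⊕ # 1F)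
                              (# 0F ⊕ # 1F ⊕ (# 3F ⊕ # 2F ⊕ # 4F) ⊕ # 5F) refl
                     ((x ∷ []) ∷ (z ∷ []) ∷ (v ∷ []) ∷ p ∷ (e₀ ∷ e) ∷ (c ∷ q₁) ∷ []))
            (prep x (prep z (↭-reflexive (sym l≡₁)))))
        where
        re : Path e₀ (e₀ ∷ e) y
        re = suffix (c ∷ q₁ ++ p ++ v ∷ []) (recast (≡-trans (cong ((c ∷ q₁) ++_) (sym (++-assoc p (v ∷ []) (e₀ ∷ e))))
          (sym (++-assoc (c ∷ q₁) (p ++ v ∷ []) (e₀ ∷ e)))) r)

  -- Rerouting a longest cycle along an ear

  module EarCycles (k : ℕ)
    (longest : ∀ {a l b} → Path a l b → b ∼ a → Unique l → cnt X l ≤ k)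
    (two-neighbours-absurd : ∀ {a l b x} → Path a l b → b ∼ a → Unique l → cnt X l ≡ k →
      x ∈ X → x ∉ₗ l → 2 ≤ cnt (neighbours G x) l → ⊥)
    where

    -- The passage from the end c of an ear to the next vertex w of X on the
    -- cycle: empty if c is in Y, and through a single vertex of Y otherwise.
    data Bridge (c : V) : List V → V → Set where
      edge : ∀ {w} → c ∈ Y → c ∼ w → Bridge c [] w
      via  : ∀ {t w} → t ∈ Y → c ∼ t → t ∼ w → Bridge c (t ∷ []) w

    bridge-X : ∀ {c τ w} → Bridge c τ w → cnt X τ ≡ 0
    bridge-X (edge _ _)    = refl
    bridge-X (via t∈Y _ _) = ≡-trans (+-identityʳ _) (χ-∉ (λ t∈X → X∌Y t∈X t∈Y))

    cross-bridge : ∀ {u A c τ w} → Path u A c → Bridge c τ w → ∃[ y ] (Path u (A ++ τ) y × y ∈ Y × y ∼ w)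
    cross-bridge {A = A} r (edge c∈Y c∼w)         = _ , recast (sym (++-identityʳ A)) r , c∈Y , c∼w
    cross-bridge         r (via {t} t∈Y c∼t t∼w) = t , (r , c∼t ∙ [ t ]) , t∈Y , t∼w

    upto : ∀ {a} p {x q b} → Path a (p ++ x ∷ q) b → Path a (p ++ x ∷ []) x
    upto p {x} {[]}    r with refl ← end≡ [ x ] (suffix p r) = r
    upto p {x} {_ ∷ _} r = proj₁ (split-edge p r)

    loop-trivial : ∀ {a l b} → Path a l b → a ≡ b → Unique l → ∀ {v} → v ∈ₗ l → v ≡ a
    loop-trivial [ _ ]   _    _        (here v≡a) = v≡a
    loop-trivial (_ ∷ r) refl (a∉ ∷ _) _          = ⊥-elim (All≢⇒∉ a∉ (end∈ r))

    -- The cycle is read as `A`, `τ`, `B`, `τ′`: the arcs end at the ends `c′` and `c` of the ear,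
    -- and the bridges lead on to `w` and `u`. Exchanging the arcs and reversing the ear gives a
    -- frame again, so it suffices to argue from the side of `u`.
    module Frame {u A c′ τ w B c τ′ e₁ E e₂ x}
      (rA : Path u A c′) (bA : Bridge c′ τ w) (rB : Path w B c) (bB : Bridge c τ′ u)
      (l-unique : Unique ((A ++ τ) ++ (B ++ τ′))) (l-count : cnt X ((A ++ τ) ++ (B ++ τ′)) ≡ k) (u∈X : u ∈ X) (w∈X : w ∈ X)
      (rE : Path e₁ E e₂) (c∼e₁ : c ∼ e₁) (e₂∼c′ : e₂ ∼ c′)
      (E-unique : Unique E) (E-off : ∀ {v} → v ∈ₗ E → v ∉ₗ (A ++ τ) ++ (B ++ τ′)) (x∈X : x ∈ X) (x∈E : x ∈ₗ E)
      where

      l : List V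
      l = (A ++ τ) ++ (B ++ τ′)

      -- `C` gains the outside vertices `D`, among them one of X, and gives up `rest`, which
      -- contains none.
      longer-absurd : ∀ {a C b} D rest → Unique D → (∀ {v} → v ∈ₗ D → v ∉ₗ l) → 1 ≤ cnt X D →
        Path a C b → b ∼ a → C ++ rest ↭ l ++ D → cnt X rest ≡ 0 → ⊥
      longer-absurd {C = C} D rest D-unique D-off 1≤D r e C↭ rest≡0 =
        <⇒≱ k<C (longest r e (Unique-++⁻ˡ C (Unique-resp-↭ (↭-sym C↭) (Unique-++⁺ l-unique D-unique (λ v∈l v∈D → D-off v∈D v∈l)))))
        where
        k<C : k < cnt X C
        k<C = ≤-trans (≤-reflexive (+-comm 1 k)) (≤-trans (+-monoʳ-≤ k 1≤D) (≤-reflexive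
          (≡-trans (cong (_+ cnt X D) (sym l-count)) (≡-trans (sym (cnt-++ X l D)) (≡-trans (sym (cnt-↭ X C↭))
            (≡-trans (cnt-++ X C rest) (≡-trans (cong (cnt X C +_) rest≡0) (+-identityʳ _))))))))

      segment-unique : ∀ D {D′} → E ≡ D ++ D′ → Unique D
      segment-unique D E≡ = Unique-++⁻ˡ D (subst Unique E≡ E-unique)

      segment-off : ∀ {D D′} → E ≡ D ++ D′ → ∀ {v} → v ∈ₗ D → v ∉ₗ l
      segment-off E≡ v∈D = E-off (subst (_ ∈ₗ_) (sym E≡) (∈-++⁺ˡ v∈D))

      1≤E : 1 ≤ cnt X E
      1≤E = ∈⇒1≤cnt X x∈E x∈X

      bridges-X : cnt X (τ ++ τ′) ≡ 0
      bridges-X = ≡-trans (cnt-++ X τ τ′) (cong₂ _+_ (bridge-X bA) (bridge-X bB))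

      -- The ear up to z replaces the bridge from c to u.
      detour-absurd : ∀ {z} D → Path e₁ D z → z ∼ u → Unique D → (∀ {v} → v ∈ₗ D → v ∉ₗ l) → 1 ≤ cnt X D → ⊥
      detour-absurd D rD z∼u D-unique D-off 1≤D with y , rAτ , _ , y∼w ← cross-bridge rA bA =
        longer-absurd D τ′ D-unique D-off 1≤D (rAτ , y∼w ∙ (rB , c∼e₁ ∙ rD)) z∼u
          (rearrange ((# 0F ⊕ # 1F ⊕ # 2F) ⊕ # 3F) ((# 0F ⊕ # 1F ⊕ # 3F) ⊕ # 2F) refl ((A ++ τ) ∷ B ∷ D ∷ τ′ ∷ []))
          (bridge-X bB)

      -- The vertex `z` is in Y. If it were not the first vertex of the ear, its predecessor there
      -- would be in X, and the ear up to `z` would be a detour back to `u`.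
      u-meets-ear-at-end : ∀ {z} → z ∈ₗ E → u ∼ z → z ≡ e₁
      u-meets-ear-at-end {z} z∈E u∼z with ∈-∃++ z∈E
      ... | [] , E₂ , refl = sym (start≡ rE)
      ... | s ∷ E₁ , E₂ , refl with m , rE₁ , m∼z , _ ← split E₁ rE = ⊥-elim
        (detour-absurd (s ∷ E₁ ++ z ∷ []) (upto (s ∷ E₁) rE) (∼-sym u∼z) (segment-unique _ E≡) (segment-off E≡)
          (∈⇒1≤cnt X (∈-++⁺ˡ (end∈ rE₁)) (Y→X (X→Y u∈X u∼z) (∼-sym m∼z))))
        where
        E≡ : s ∷ E₁ ++ z ∷ E₂ ≡ (s ∷ E₁ ++ z ∷ []) ++ E₂
        E≡ = sym (++-assoc (s ∷ E₁) (z ∷ []) E₂)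

      -- The detour follows the ear up to `x` and returns to `u` through `z`.
      u-x-apart : ∀ {z} → z ∉ₗ E → z ∉ₗ l → u ∼ z → x ∼ z → ⊥
      u-x-apart {z} z∉E z∉l u∼z x∼z with P , Q , refl ← ∈-∃++ x∈E =
        detour-absurd ((P ++ x ∷ []) ++ z ∷ []) (upto P rE , x∼z ∙ [ z ]) (∼-sym u∼z)
          (Unique-++⁺ (segment-unique (P ++ x ∷ []) E≡) ([] ∷ []) λ { v∈ (here refl) → z∉E (subst (_ ∈ₗ_) (sym E≡) (∈-++⁺ˡ v∈)) })
          (λ v∈ → off (∈-++⁻ (P ++ x ∷ []) v∈))
          (∈⇒1≤cnt X (∈-++⁺ˡ (∈-++⁺ʳ P (here refl))) x∈X)
        where
        E≡ : P ++ x ∷ Q ≡ (P ++ x ∷ []) ++ Q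
        E≡ = sym (++-assoc P (x ∷ []) Q)
        off : ∀ {v} → v ∈ₗ P ++ x ∷ [] ⊎ v ∈ₗ z ∷ [] → v ∉ₗ l
        off (inj₁ v∈)          = segment-off E≡ v∈
        off (inj₂ (here refl)) = z∉l

      -- The longer cycle is u ⋯ c′ E c ⋯ w z.
      u-w-apart : ∀ {z} → z ∉ₗ E → z ∉ₗ l → u ∼ z → w ∼ z → ⊥
      u-w-apart {z} z∉E z∉l u∼z w∼z =
        longer-absurd (E ++ z ∷ []) (τ ++ τ′)
          (Unique-++⁺ E-unique ([] ∷ []) λ { v∈ (here refl) → z∉E v∈ })
          (λ v∈ → off (∈-++⁻ E v∈))
          (≤-trans 1≤E (≤-trans (m≤m+n _ _) (≤-reflexive (sym (cnt-++ X E (z ∷ []))))))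
          (rA , ∼-sym e₂∼c′ ∙ (rev rE , ∼-sym c∼e₁ ∙ (rev rB , w∼z ∙ [ z ]))) (∼-sym u∼z)
          (rearrange ((# 0F ⊕ ↶ # 4F ⊕ ↶ # 2F ⊕ # 5F) ⊕ # 1F ⊕ # 3F) (((# 0F ⊕ # 1F) ⊕ # 2F ⊕ # 3F) ⊕ # 4F ⊕ # 5F) refl
            (A ∷ τ ∷ B ∷ τ′ ∷ E ∷ (z ∷ []) ∷ []))
          bridges-X
        where
        off : ∀ {v} → v ∈ₗ E ⊎ v ∈ₗ z ∷ [] → v ∉ₗ l
        off (inj₁ v∈)          = E-off v∈
        off (inj₂ (here refl)) = z∉l

      -- The cycle u ⋯ c′ e₂ w ⋯ c e₁ misses x, which is adjacent to e₁ and e₂.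
      both-ends-absurd : e₁ ≢ e₂ → u ∼ e₁ → x ∼ e₁ → w ∼ e₂ → x ∼ e₂ → ⊥
      both-ends-absurd e₁≢e₂ u∼e₁ x∼e₁ w∼e₂ x∼e₂ =
        two-neighbours-absurd (rA , ∼-sym e₂∼c′ ∙ ([ e₂ ] , ∼-sym w∼e₂ ∙ (rB , c∼e₁ ∙ [ e₁ ]))) (∼-sym u∼e₁)
          (Unique-++⁻ˡ C C++-unique) C-count x∈X x∉C
          (∈∈⇒2≤cnt (neighbours G x) e₁≢e₂ (∈-++⁺ʳ A (there (∈-++⁺ʳ B (here refl)))) (∈-++⁺ʳ A (here refl)) x∼e₁ x∼e₂)
        where
        C D : List V
        C = A ++ e₂ ∷ B ++ e₁ ∷ []
        D = e₁ ∷ e₂ ∷ []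
        C↭ : C ++ τ ++ τ′ ↭ l ++ D
        C↭ = rearrange ((# 0F ⊕ # 5F ⊕ # 2F ⊕ # 4F) ⊕ # 1F ⊕ # 3F) (((# 0F ⊕ # 1F) ⊕ # 2F ⊕ # 3F) ⊕ # 4F ⊕ # 5F) refl
               (A ∷ τ ∷ B ∷ τ′ ∷ (e₁ ∷ []) ∷ (e₂ ∷ []) ∷ [])
        D⊆E : ∀ {v} → v ∈ₗ D → v ∈ₗ E
        D⊆E (here refl)         = start∈ rE
        D⊆E (there (here refl)) = end∈ rE
        D∌x : ∀ {v} → v ∈ₗ D → v ∉ X
        D∌x (here refl)         v∈X = X∌Y v∈X (X→Y x∈X x∼e₁)
        D∌x (there (here refl)) v∈X = X∌Y v∈X (X→Y x∈X x∼e₂)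
        C++-unique : Unique (C ++ τ ++ τ′)
        C++-unique = Unique-resp-↭ (↭-sym C↭)
          (Unique-++⁺ l-unique ((e₁≢e₂ ∷ []) ∷ [] ∷ []) (λ v∈l v∈D → E-off (D⊆E v∈D) v∈l))
        C-count : cnt X C ≡ k
        C-count = ≡-trans (sym (+-identityʳ _)) (≡-trans (cong (cnt X C +_) (sym bridges-X))
          (≡-trans (sym (cnt-++ X C (τ ++ τ′))) (≡-trans (cnt-↭ X C↭) (≡-trans (cnt-++ X l D)
            (≡-trans (cong (cnt X l +_) (cnt-∉ X D∌x)) (≡-trans (+-identityʳ _) l-count))))))
        x∉C : x ∉ₗ C
        x∉C x∈C = off (∈-++⁻ l (∈-resp-↭ C↭ (∈-++⁺ˡ x∈C)))
          where
          off : x ∈ₗ l ⊎ x ∈ₗ D → ⊥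
          off (inj₁ x∈l) = E-off x∈E x∈l
          off (inj₂ x∈D) = D∌x x∈D x∈X

      -- The cycle u ⋯ y w ⋯ c E c′ ⋯ y′ misses v, which is adjacent to y and y′.
      crossing-inside : ∀ {y v y′} p q → A ≡ p ++ v ∷ q → v ∈ X → Path u p y → y ∼ v → v ∼ y′ → Path y′ q c′ →
        w ∼ y → u ∼ y′ → ⊥
      crossing-inside {y} {v} {y′} p q refl v∈X rp y∼v v∼y′ rq w∼y u∼y′ =
        two-neighbours-absurd C-path (∼-sym u∼y′) C-unique C-count v∈X
          (λ v∈C → Unique-disjoint C all-unique v∈C (here refl))
          (∈∈⇒2≤cnt (neighbours G v) y≢y′ (∈-++⁺ˡ (end∈ rp)) y′∈C (∼-sym y∼v) v∼y′)
        where
        C : List V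
        C = p ++ B ++ E ++ reverse q
        C-path : Path u C y′
        C-path = rp , ∼-sym w∼y ∙ (rB , c∼e₁ ∙ (rE , e₂∼c′ ∙ rev rq))
        C↭ : C ++ v ∷ τ ++ τ′ ↭ l ++ E
        C↭ = rearrange ((# 0F ⊕ # 4F ⊕ # 6F ⊕ ↶ # 2F) ⊕ # 1F ⊕ # 3F ⊕ # 5F)
               ((((# 0F ⊕ # 1F ⊕ # 2F) ⊕ # 3F) ⊕ # 4F ⊕ # 5F) ⊕ # 6F) refl
               (p ∷ (v ∷ []) ∷ q ∷ τ ∷ B ∷ τ′ ∷ E ∷ [])
        all-unique : Unique (C ++ v ∷ τ ++ τ′)
        all-unique = Unique-resp-↭ (↭-sym C↭) (Unique-++⁺ l-unique E-unique (λ v∈l v∈E → E-off v∈E v∈l))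
        C-unique : Unique C
        C-unique = Unique-++⁻ˡ C all-unique
        C+1≡k+E : suc (cnt X C) ≡ k + cnt X E
        C+1≡k+E = ≡-trans (+-comm 1 (cnt X C)) (≡-trans (cong (cnt X C +_) (sym rest≡1))
          (≡-trans (sym (cnt-++ X C (v ∷ τ ++ τ′))) (≡-trans (cnt-↭ X C↭) (≡-trans (cnt-++ X l E) (cong (_+ cnt X E) l-count)))))
          where
          rest≡1 : cnt X (v ∷ τ ++ τ′) ≡ 1
          rest≡1 = cong₂ _+_ (χ-∈ v∈X) bridges-X
        C-count : cnt X C ≡ k
        -- Leaving out `v` costs one vertex of X and the ear brings in at least one, so the count is
        -- at least `k`; maximality gives the other inequality.
        C-count = ≤-antisym (longest C-path (∼-sym u∼y′) C-unique)
          (≤-pred (≤-trans (≤-reflexive (+-comm 1 k)) (≤-trans (+-monoʳ-≤ k 1≤E) (≤-reflexive (sym C+1≡k+E)))))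
        y′∈tail : y′ ∈ₗ B ++ E ++ reverse q
        y′∈tail = ∈-++⁺ʳ B (∈-++⁺ʳ E (end∈ (rev rq)))
        y′∈C : y′ ∈ₗ C
        y′∈C = ∈-++⁺ʳ p y′∈tail
        y≢y′ : y ≢ y′
        y≢y′ refl = Unique-disjoint p C-unique (end∈ rp) y′∈tail

      -- Here v = c′, and u ⋯ y w ⋯ c E c′ t misses no vertex of X.
      crossing-at-end : ∀ {y t} p → A ≡ p ++ c′ ∷ [] → τ ≡ t ∷ [] → Path u p y → c′ ∼ t → w ∼ y → u ∼ t → ⊥
      crossing-at-end {y} {t} p refl refl rp c′∼t w∼y u∼t =
        longer-absurd E τ′ E-unique E-off 1≤E
          (rp , ∼-sym w∼y ∙ (rB , c∼e₁ ∙ (rE , e₂∼c′ ∙ (c′∼t ∷ [ t ])))) (∼-sym u∼t)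
          (rearrange ((# 0F ⊕ # 3F ⊕ # 5F ⊕ # 1F ⊕ # 2F) ⊕ # 4F) ((((# 0F ⊕ # 1F) ⊕ # 2F) ⊕ # 3F ⊕ # 4F) ⊕ # 5F) refl
            (p ∷ (c′ ∷ []) ∷ (t ∷ []) ∷ B ∷ τ′ ∷ E ∷ []))
          (bridge-X bB)

      -- The crossing lies on the arc `A` extended by the bridge. Something follows `v` there, so
      -- `v` is not the bridge vertex: either `v` and its successor both lie on `A`, or `v` is `c′`
      -- and its successor is the bridge vertex.
      crossing-absurd : ∀ {y₃} → Crossing u w u (A ++ τ) y₃ → ⊥
      crossing-absurd (crossed {p = p} {q} A≡ v∈X rp y∼v v∼y′ rq w∼y u∼y′) = cases bA refl A≡
        where
        cases : ∀ {σ} → Bridge c′ σ w → τ ≡ σ → A ++ τ ≡ p ++ _ ∷ q → ⊥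
        cases (edge _ _) refl eq
          with refl ← end≡ (v∼y′ ∷ rq) (suffix p (recast (≡-trans (sym (++-identityʳ A)) eq) rA)) =
          crossing-inside p q (≡-trans (sym (++-identityʳ A)) eq) v∈X rp y∼v v∼y′ rq w∼y u∼y′
        cases (via {t} t∈Y c′∼t t∼w) refl eq with compare-cuts A (t ∷ []) p (_ ∷ q) eq
        ... | inj₁ ([] , _ , eq′) with refl , refl ← ∷-injective eq′ = case rq of λ ()
        ... | inj₁ (_ ∷ [] , _ , ())
        ... | inj₁ (_ ∷ _ ∷ _ , _ , ())
        ... | inj₂ (_ , [] , refl , refl) with refl ← start≡ rq with refl ← end≡ [ _ ] (suffix p rA) =
          crossing-at-end p refl refl rp c′∼t w∼y u∼y′
        ... | inj₂ (_ , s ∷ e , refl , refl) with refl ← start≡ rq with _ , _ , _ , rq′ ← split [] (suffix p rA) =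
          crossing-inside p (s ∷ e) refl v∈X rp y∼v v∼y′ rq′ w∼y u∼y′

    -- Ears from 2-connectedness

    record Ear (l : List V) : Set where
      field
        {c c′ e₁ e₂ x} : V
        {E}      : List V
        c∈l      : c ∈ₗ l
        c′∈l     : c′ ∈ₗ l
        c≢c′     : c ≢ c′
        E-path   : Path e₁ E e₂
        c∼e₁     : c ∼ e₁
        e₂∼c′    : e₂ ∼ c′
        E-unique : Unique E
        E-off    : ∀ {v} → v ∈ₗ E → v ∉ₗ l
        x∈X      : x ∈ X
        x∈E      : x ∈ₗ E

    first-hit : ∀ {S x v l} → Star (AdjacentAvoiding G S) x v → x ∉ₗ l → v ∈ₗ l →
      ∃[ p ] ∃[ r ] ∃[ c ] (Path x p r × (∀ {v} → v ∈ₗ p → v ∉ₗ l × v ∉ S) × r ∼ c × c ∈ₗ l × c ∉ S)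
    first-hit ε x∉l x∈l = ⊥-elim (x∉l x∈l)
    first-hit {l = l} (_◅_ {x} {y} (x∉S , y∉S , x∼y) walk) x∉l v∈l with y ∈ₗ? l
    ... | yes y∈l = x ∷ [] , x , y , [ x ] , (λ { (here refl) → x∉l , x∉S }) , x∼y , y∈l , y∉S
    ... | no  y∉l with p , r , c , rp , off , r∼c , c∈l , c∉S ← first-hit walk y∉l v∈l =
      x ∷ p , r , c , x∼y ∷ rp , (λ { (here refl) → x∉l , x∉S ; (there v∈p) → off v∈p }) , r∼c , c∈l , c∉S

    concat : ∀ {a p b q c} → Path a p b → Path b q c → ∃[ r ] (Path a r c × (∀ {v} → v ∈ₗ r → v ∈ₗ p ⊎ v ∈ₗ q))
    concat [ _ ]   rq = _ , rq , inj₂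
    concat (e ∷ rp) rq with r , rr , ⊆ ← concat rp rq =
      _ , e ∷ rr , λ { (here refl) → inj₁ (here refl) ; (there v∈) → case ⊆ v∈ of λ
      { (inj₁ v∈p) → inj₁ (there v∈p) ; (inj₂ v∈q) → inj₂ v∈q } }

    off-path : ∀ {l x p a q b} → Path x p a → Path x q b → (∀ {v} → v ∈ₗ p → v ∉ₗ l) → (∀ {v} → v ∈ₗ q → v ∉ₗ l) →
      ∃[ E ] (Path a E b × Unique E × (∀ {v} → v ∈ₗ E → v ∉ₗ l))
    off-path {l} {p = p} rp rq p-off q-off with r , rr , r⊆ ← concat (rev rp) rq with E , rE , uE , E⊆ ← simplify rr =
      E , rE , uE , λ v∈E → either (r⊆ (E⊆ v∈E))
      where
      either : ∀ {v} → v ∈ₗ reverse p ⊎ v ∈ₗ _ → v ∉ₗ l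
      either (inj₁ v∈) = p-off (∈-resp-↭ (↭-reverse p) v∈)
      either (inj₂ v∈) = q-off v∈

    meets-X : ∀ {a l b} → Path a l b → a ≢ b → ∃[ x ] (x ∈ X × x ∈ₗ l)
    meets-X [ _ ]      a≢a = ⊥-elim (a≢a refl)
    meets-X {a} (e ∷ r) _ with X⊎Y a
    ... | inj₁ a∈X = a , a∈X , here refl
    ... | inj₂ a∈Y = _ , Y→X a∈Y e , there (start∈ r)

    distinct-from : ∀ {l : List V} {c d} → c ∈ₗ l → d ∈ₗ l → c ≢ d → ∀ v → ∃[ o ] (o ∈ₗ l × o ≢ v)
    distinct-from {c = c} c∈l d∈l c≢d v with c Fin.≟ v
    ... | no  c≢v  = c , c∈l , c≢v
    ... | yes refl = _ , d∈l , c≢d ∘ sym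

    module _ (connected : ∀ c → ConnectedAfterDeleting G ⁅ c ⁆) where

      hit-avoiding : ∀ s {x v l} → x ≢ s → v ≢ s → x ∉ₗ l → v ∈ₗ l →
        ∃[ p ] ∃[ r ] ∃[ c ] (Path x p r × (∀ {v} → v ∈ₗ p → v ∉ₗ l) × r ∼ c × c ∈ₗ l × r ≢ s × c ≢ s)
      hit-avoiding s x≢s v≢s x∉l v∈l
        with p , r , c , rp , off , r∼c , c∈l , c∉ ← first-hit (connected s (x≢s ∘ x∈⁅y⁆⇒x≡y s) (v≢s ∘ x∈⁅y⁆⇒x≡y s)) x∉l v∈l =
        p , r , c , rp , proj₁ ∘ off , r∼c , c∈l ,
        (λ { refl → proj₂ (off (end∈ rp)) (x∈⁅x⁆ s) }) , (λ { refl → c∉ (x∈⁅x⁆ s) })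

      -- One path from `x` reaches the cycle at `c₁`; another, found after deleting `c₁`, reaches it
      -- at some `c₂`. Making their union a simple path may lose `x`, so a vertex of X is found
      -- anew: if `r₁` and `r₂` differ, the ear contains an edge.
      ear : ∀ {l c d x} → c ∈ₗ l → d ∈ₗ l → c ≢ d → x ∈ X → x ∉ₗ l → Ear l
      ear {l} {c} {d} {x} c∈l d∈l c≢d x∈X x∉l
        with p₁ , r₁ , c₁ , rp₁ , off₁ , r₁∼c₁ , c₁∈l , _ , _ ← hit-avoiding d (λ { refl → x∉l d∈l }) c≢d x∉l c∈l
        with other , other∈l , other≢c₁ ← distinct-from c∈l d∈l c≢d c₁
        with p₂ , r₂ , c₂ , rp₂ , off₂ , r₂∼c₂ , c₂∈l , _ , c₂≢c₁ ←
          hit-avoiding c₁ (λ { refl → x∉l c₁∈l }) other≢c₁ x∉l other∈l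
        with r₁ Fin.≟ r₂
      ... | no r₁≢r₂
        with E , rE , uE , E-off ← off-path rp₁ rp₂ off₁ off₂ with x′ , x′∈X , x′∈E ← meets-X rE r₁≢r₂ = record
        { c∈l = c₁∈l ; c′∈l = c₂∈l ; c≢c′ = c₂≢c₁ ∘ sym ; E-path = rE ; c∼e₁ = ∼-sym r₁∼c₁ ; e₂∼c′ = r₂∼c₂
        ; E-unique = uE ; E-off = E-off ; x∈X = x′∈X ; x∈E = x′∈E }
      ... | yes refl with X⊎Y r₁
      ... | inj₁ r₁∈X = record
        { c∈l = c₁∈l ; c′∈l = c₂∈l ; c≢c′ = c₂≢c₁ ∘ sym ; E-path = [ r₁ ] ; c∼e₁ = ∼-sym r₁∼c₁ ; e₂∼c′ = r₂∼c₂
        ; E-unique = [] ∷ [] ; E-off = λ { (here refl) → off₁ (end∈ rp₁) } ; x∈X = r₁∈X ; x∈E = here refl }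
      -- A single vertex of Y is not enough; deleting it, x reaches l elsewhere.
      ... | inj₂ r₁∈Y
        with p₃ , r₃ , c₃ , rp₃ , off₃ , r₃∼c₃ , c₃∈l , r₃≢r₁ , _ ←
          hit-avoiding r₁ (X≢Y x∈X r₁∈Y) (λ { refl → off₁ (end∈ rp₁) c₁∈l }) x∉l c₁∈l
        with E , rE , uE , E-off ← off-path rp₁ rp₃ off₁ off₃ with x′ , x′∈X , x′∈E ← meets-X rE (r₃≢r₁ ∘ sym)
        with c₁ Fin.≟ c₃
      ... | no  c₁≢c₃ = record
        { c∈l = c₁∈l ; c′∈l = c₃∈l ; c≢c′ = c₁≢c₃ ; E-path = rE ; c∼e₁ = ∼-sym r₁∼c₁ ; e₂∼c′ = r₃∼c₃
        ; E-unique = uE ; E-off = E-off ; x∈X = x′∈X ; x∈E = x′∈E }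
      -- The new path returns to `c₁`. Since `r₁` is adjacent to `c₂` as well, the ear is attached
      -- there instead.
      ... | yes refl = record
        { c∈l = c₂∈l ; c′∈l = c₃∈l ; c≢c′ = c₂≢c₁ ; E-path = rE ; c∼e₁ = ∼-sym r₂∼c₂ ; e₂∼c′ = r₃∼c₃
        ; E-unique = uE ; E-off = E-off ; x∈X = x′∈X ; x∈E = x′∈E }

  -- Degree counts on and off a longest cycle

  module Dense (k : ℕ)
    (longest : ∀ {a l b} → Path a l b → b ∼ a → Unique l → cnt X l ≤ k)
    (m δ : ℕ) (k<X : k < ∣ X ∣) (X≤δ : ∣ X ∣ ≤ δ) (∣Y∣≡m : ∣ Y ∣ ≡ m) (m+5≤3δ : m + 5 ≤ 3 * δ)
    (δ≤deg : ∀ {x} → x ∈ X → δ ≤ degree G x)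
    (second-neighbour : ∀ {z x} → z ∈ Y → x ∈ X → ∃[ v ] (z ∼ v × v ≢ x))
    where

    open LongestCycles k longest
    open Succ

    k<δ : k < δ
    k<δ = ≤-trans k<X X≤δ

    module OffPart {l : List V} (l-unique : Unique l) (l-count : cnt X l ≡ k) (l-balanced : cnt X l ≡ cnt Y l) where

      R : List V
      R = proj₁ (off-part l-unique)

      split-count : ∀ S → ∣ S ∣ ≡ cnt S l + cnt S R
      split-count = proj₁ (proj₂ (off-part l-unique))

      R-unique : Unique R
      R-unique = proj₁ (proj₂ (proj₂ (off-part l-unique)))

      R-off : ∀ {z} → z ∈ₗ R → z ∉ₗ l
      R-off = proj₁ (proj₂ (proj₂ (proj₂ (off-part l-unique))))

      off-R : ∀ {z} → z ∉ₗ l → z ∈ₗ R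
      off-R = proj₂ (proj₂ (proj₂ (proj₂ (off-part l-unique))))

      Y-count : cnt Y l ≡ k
      Y-count = ≡-trans (sym l-balanced) l-count

      k+R≤ : (k + cnt Y R) + 5 ≤ 3 * δ
      k+R≤ = subst (λ c → c + 5 ≤ 3 * δ) (≡-trans (sym ∣Y∣≡m) (≡-trans (split-count Y) (cong (_+ cnt Y R) Y-count))) m+5≤3δ

      δ≤cnt : ∀ {x} → x ∈ X → δ ≤ cnt (neighbours G x) l + cnt (neighbours G x) R
      δ≤cnt {x} x∈X = ≤-trans (δ≤deg x∈X) (≤-reflexive (split-count (neighbours G x)))

      χ-nbr≤ : ∀ {x} → x ∈ X → ∀ v → χ (neighbours G x) v ≤ χ Y v
      χ-nbr≤ {x} x∈X v with v ∈? neighbours G x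
      ... | yes x∼v rewrite χ-∈ x∼v | χ-∈ (X→Y x∈X x∼v) = ≤-refl
      ... | no  x≁v rewrite χ-∉ x≁v = z≤n

      cnt-nbr≤k : ∀ {x} → x ∈ X → cnt (neighbours G x) l ≤ k
      cnt-nbr≤k {x} x∈X = ≤-trans (cnt-mono (neighbours G x) Y l (λ {v} _ → χ-nbr≤ x∈X v)) (≤-reflexive Y-count)

      cnt-nbr<k : ∀ {x y} → x ∈ X → y ∈ₗ l → y ∈ Y → ¬ x ∼ y → cnt (neighbours G x) l < k
      cnt-nbr<k {x} {y} x∈X y∈l y∈Y x≁y with p , q , refl ← ∈-∃++ y∈l =
        subst₂ _<_ (sym (cnt-↭ S (shift y p q))) (≡-trans (sym (cnt-↭ Y (shift y p q))) Y-count) less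
        where
        S = neighbours G x
        less : cnt S (y ∷ p ++ q) < cnt Y (y ∷ p ++ q)
        less rewrite χ-∈ y∈Y | χ-∉ x≁y = s≤s (cnt-mono S Y (p ++ q) (λ {v} _ → χ-nbr≤ x∈X v))

      one-off : ∀ {x} → x ∈ X → 1 ≤ cnt (neighbours G x) R
      one-off {x} x∈X = +-cancelˡ-≤ k _ _ (≤-trans (≤-trans (≤-reflexive (+-comm k 1)) k<δ)
        (≤-trans (δ≤cnt x∈X) (+-monoˡ-≤ (cnt (neighbours G x) R) (cnt-nbr≤k x∈X))))

    -- All cycles with `k` vertices of X are compared, because the condition is applied to a
    -- rerouted cycle and the vertex that it omits.
    Best : ℕ → Set
    Best t = ∀ {a l b v} → Path a l b → b ∼ a → Unique l → cnt X l ≡ k → v ∈ X → v ∉ₗ l →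
      t < cnt (neighbours G v) l → ⊥

    private
      same-∈ : ∀ (S : Subset N) {v w} → v ∈ S → w ∈ S → χ S v ≡ χ S w
      same-∈ S v∈S w∈S = ≡-trans (χ-∈ v∈S) (sym (χ-∈ w∈S))

      same-∉ : ∀ (S : Subset N) {v w} → v ∉ S → w ∉ S → χ S v ≡ χ S w
      same-∉ S v∉S w∉S = ≡-trans (χ-∉ v∉S) (sym (χ-∉ w∉S))

    module Arcs {u A y₃ w B y₄ x} (rA : Path u A y₃) (y₃∼w : y₃ ∼ w) (rB : Path w B y₄) (y₄∼u : y₄ ∼ u)
      (l-unique : Unique (A ++ B)) (l-count : cnt X (A ++ B) ≡ k)
      (x∈X : x ∈ X) (x∉l : x ∉ₗ A ++ B) (x∼y₃ : x ∼ y₃) (x∼y₄ : x ∼ y₄) where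

      l : List V
      l = A ++ B

      l-path : Path u l y₄
      l-path = rA , y₃∼w ∙ rB

      t : ℕ
      t = cnt (neighbours G x) l

      open Inserting l-unique l-count x∈X x∉l public
      open OffPart l-unique l-count (balanced l-path y₄∼u) public

      u∈X : u ∈ X
      u∈X = Y→X (X→Y x∈X x∼y₄) y₄∼u

      w∈X : w ∈ X
      w∈X = Y→X (X→Y x∈X x∼y₃) y₃∼w

      apart-x-succ : ∀ {c} → Succ l x c → Apart R x c
      apart-x-succ s z z∈R x∼z c∼z = succ-apart s x∼z (∼-sym c∼z) (R-off z∈R)

      apart-succs : ∀ {c c′} → Succ l x c → Succ l x c′ → c ≢ c′ → Apart R c c′
      apart-succs s s′ c≢c′ z z∈R c∼z c′∼z =
        succs-apart s s′ c≢c′ c∼z c′∼z (X≢Y x∈X (X→Y (succ∈X s x∈X) c∼z)) (R-off z∈R)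

      u-succ : Succ l x u
      u-succ with r , refl ← path-head rA =
        succ {p = []} {q = r ++ B} refl (recast (cong (u ∷_) (sym (++-identityʳ (r ++ B)))) l-path) y₄∼u x∼y₄

      w-succ : Succ l x w
      w-succ with r , refl ← path-head rB = succ {p = A} {q = r} refl (rB , y₄∼u ∙ rA) y₃∼w x∼y₃

      u≢w : u ≢ w
      u≢w refl = Unique-disjoint A l-unique (start∈ rA) (start∈ rB)

      -- The vertices `x`, `u` and `w` enter with their full degrees. Each of the other successors,
      -- at least `t` minus two in number, enters with a single neighbour off the cycle.
      few-edges-absurd :
        cnt (neighbours G u) A + cnt (neighbours G w) A ≤ suc (cnt X A) →
        cnt (neighbours G w) B + cnt (neighbours G u) B ≤ suc (cnt X B) → ⊥
      few-edges-absurd fewA fewB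
        with U , U-unique , U-length , U-succ ← all-succs l-path y₄∼u x∼y₄ l-unique
        with U₁ , U₁-unique , U₁⊆ , len₁ ← remove u U-unique
        with U₂ , U₂-unique , U₂⊆ , len₂ ← remove w U₁-unique =
        few-edges-arith {a = cnt X A} {b = cnt X B} {S = degree-sum R U₂} {L = length U₂}
          {ou = cnt (neighbours G u) R} {ow = cnt (neighbours G w) R}
          {uA = cnt (neighbours G u) A} {wA = cnt (neighbours G w) A} {uB = cnt (neighbours G u) B} {wB = cnt (neighbours G w) B}
          (δ≤cnt x∈X) (split-δ u∈X) (split-δ w∈X) fewA fewB
          (apart-bound R family λ { (here refl) → x∈X ; (there (here refl)) → u∈X ; (there (there (here refl))) → w∈X
                                  ; (there (there (there c∈))) → succ∈X (succ-of c∈) x∈X })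
          (≤-trans (≤-reflexive (sym (*-identityˡ _))) (degree-sum-lower 1 R U₂ (λ c∈ → one-off (succ∈X (succ-of c∈) x∈X))))
          (≤-trans (≤-reflexive (sym U-length)) (≤-trans len₁ (s≤s len₂)))
          (subst (λ c → (c + cnt Y R) + 5 ≤ 3 * δ) (≡-trans (sym l-count) (cnt-++ X A B)) k+R≤)
        where
        split-δ : ∀ {v} → v ∈ X → δ ≤ (cnt (neighbours G v) A + cnt (neighbours G v) B) + cnt (neighbours G v) R
        split-δ {v} v∈X = subst (λ c → δ ≤ c + cnt (neighbours G v) R) (cnt-++ (neighbours G v) A B) (δ≤cnt v∈X)
        succ-of : ∀ {c} → c ∈ₗ U₂ → Succ l x c
        succ-of c∈ = U-succ (proj₁ (U₁⊆ (proj₁ (U₂⊆ c∈))))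
        family : AllPairs (Apart R) (x ∷ u ∷ w ∷ U₂)
        family =
          (apart-x-succ u-succ ∷ apart-x-succ w-succ ∷ All.tabulate (λ c∈ → apart-x-succ (succ-of c∈))) ∷
          (apart-succs u-succ w-succ u≢w ∷
            All.tabulate (λ c∈ → apart-succs u-succ (succ-of c∈) (proj₂ (U₁⊆ (proj₁ (U₂⊆ c∈))) ∘ sym))) ∷
          All.tabulate (λ c∈ → apart-succs w-succ (succ-of c∈) (proj₂ (U₂⊆ c∈) ∘ sym)) ∷
          unique⇒AllPairs U₂-unique (λ c∈ c′∈ → apart-succs (succ-of c∈) (succ-of c′∈))

      -- If δ = k + 1, then x is the only vertex of X off the cycle, so a
      -- neighbour z of x off the cycle has another neighbour v on it, and no
      -- successor is adjacent to the vertex following v.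
      off-succ : δ ≤ suc k → ∀ {c} → Succ l x c → cnt (neighbours G c) l < k
      off-succ δ≤1+k {c} s
        with z , z∈R , x∼z ← cnt-pos (neighbours G x) (one-off x∈X)
        with v , z∼v , v≢x ← second-neighbour (X→Y x∈X x∼z) x∈X
        with v∈X ← Y→X (X→Y x∈X x∼z) z∼v
        with v ∈ₗ? l
      ... | no  v∉l = ⊥-elim (1+n≰n (≤-trans k+2≤X (≤-trans X≤δ δ≤1+k)))
        where
        k+2≤X : 2 + k ≤ ∣ X ∣
        k+2≤X = subst₂ _≤_ (+-comm k 2) (sym (≡-trans (split-count X) (cong (_+ cnt X R) l-count)))
          (+-monoʳ-≤ k (∈∈⇒2≤cnt X v≢x (off-R v∉l) (off-R x∉l) v∈X x∈X))
      ... | yes v∈l with ∈-∃++ (∈-resp-↭ (↭-sym (cyclic s)) v∈l)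
      ... | p , [] , eq with refl ← end≡ [ v ] (suffix p (recast eq (path s))) = ⊥-elim (X∌Y v∈X (X→Y x∈X (x∼y s)))
      ... | p , y′ ∷ q , eq with rp , v∼y′ , rq ← split-edge p (recast eq (path s)) with y′ ∈? neighbours G c
      ... | yes c∼y′ = ⊥-elim (insert-over-chord arcs↭l rp rq (x∼y s) c∼y′ (∼-sym z∼v) x∼z (R-off z∈R))
        where
        arcs↭l : (p ++ v ∷ []) ++ y′ ∷ q ↭ l
        arcs↭l = ↭-trans (↭-reflexive (≡-trans (++-assoc p (v ∷ []) (y′ ∷ q)) (sym eq))) (cyclic s)
      ... | no  c≁y′ = cnt-nbr<k (succ∈X s x∈X) y′∈l (X→Y v∈X v∼y′) c≁y′
        where
        y′∈l : y′ ∈ₗ l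
        y′∈l = ∈-resp-↭ (cyclic s) (subst (y′ ∈ₗ_) (sym eq) (∈-++⁺ʳ p (there (here refl))))

      -- A successor has at most `k` neighbours on the cycle, hence at least δ - k off it, and for δ
      -- ≥ k + 2 this is `2 + s` with s = δ - k - 2. For δ = k + 1 it is only one, and `off-succ`
      -- supplies the second, so that `s` is 0.
      succ-off-bound : ∃[ s ] (δ ≤ k + (2 + s) × (∀ {c} → Succ l x c → 2 + s ≤ cnt (neighbours G c) R))
      succ-off-bound with δ ≤? suc k
      ... | yes δ≤1+k = 0 , ≤-trans δ≤1+k (≤-trans (n≤1+n _) (≤-reflexive (+-comm 2 k))) ,
        λ s → +-cancelˡ-≤ k _ _ (≤-trans (≤-trans (≤-reflexive (+-comm k 2)) (s≤s k<δ))
                (≤-trans (s≤s (δ≤cnt (succ∈X s x∈X))) (+-monoˡ-≤ _ (off-succ δ≤1+k s))))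
      ... | no  δ≰1+k with j , refl ← m≤n⇒∃[o]m+o≡n (≰⇒> δ≰1+k) =
        j , ≤-reflexive (reassoc k j) ,
        λ s → +-cancelˡ-≤ k _ _ (≤-trans (≤-reflexive (sym (reassoc k j)))
                (≤-trans (δ≤cnt (succ∈X s x∈X)) (+-monoˡ-≤ _ (cnt-nbr≤k (succ∈X s x∈X)))))
        where
        reassoc : ∀ k j → 2 + k + j ≡ k + (2 + j)
        reassoc = solve-∀

      -- The cycle u ⋯ y w ⋯ y₄ x y₃ ⋯ y′ has `x` in place of `v`, so `best` limits the neighbours
      -- of `v` on it. The count then uses `x`, `v` and the successors other than `v`.
      crossed-absurd :
        Best t → 2 ≤ t → Crossing u w u A y₃ → ⊥
      crossed-absurd best 2≤t (crossed {y} {v} {y′} {p} {q} A≡ v∈X rp y∼v v∼y′ rq w∼y u∼y′)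
        with t′ , 2+t′≡t ← m≤n⇒∃[o]m+o≡n 2≤t
        with s , δ≤ , off-succs ← succ-off-bound
        with U , U-unique , U-length , U-succ ← all-succs l-path y₄∼u x∼y₄ l-unique
        with U₁ , U₁-unique , U₁⊆ , len₁ ← remove v U-unique =
        crossed-arith {k = k} {s = s} {t = t′} {cv = cnt (neighbours G v) l} {ov = cnt (neighbours G v) R} {S = degree-sum R U₁} δ≤
          (subst (λ c → δ ≤ c + cnt (neighbours G x) R) (sym 2+t′≡t) (δ≤cnt x∈X)) (δ≤cnt v∈X)
          (subst (cnt (neighbours G v) l ≤_) (sym 2+t′≡t) (≮⇒≥ better))
          (≤-trans (*-monoʳ-≤ (2 + s) (≤-pred (≤-trans (≤-reflexive (≡-trans 2+t′≡t (sym U-length))) len₁)))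
            (degree-sum-lower (2 + s) R U₁ (λ c∈ → off-succs (U-succ (proj₁ (U₁⊆ c∈))))))
          (apart-bound R family λ { (here refl) → x∈X ; (there (here refl)) → v∈X ; (there (there c∈)) → succ∈X (succ-of c∈) x∈X })
          k+R≤
        where
        C : List V
        C = p ++ B ++ x ∷ reverse q

        l-cut : l ≡ p ++ v ∷ q ++ B
        l-cut = ≡-trans (cong (_++ B) A≡) (++-assoc p (v ∷ q) B)

        vC↭xl : v ∷ C ↭ x ∷ l
        vC↭xl = ↭-trans (rearrange (# 0F ⊕ # 2F ⊕ # 4F ⊕ # 1F ⊕ ↶ # 3F) (# 1F ⊕ # 2F ⊕ # 0F ⊕ # 3F ⊕ # 4F) refl
                          ((v ∷ []) ∷ (x ∷ []) ∷ p ∷ q ∷ B ∷ []))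
                  (prep x (↭-reflexive (sym l-cut)))

        vC-unique : Unique (v ∷ C)
        vC-unique = Unique-resp-↭ (↭-sym vC↭xl) (∉⇒All≢ x∉l ∷ l-unique)

        -- Applied to X, which contains both `v` and `x`, and to the neighbourhood of `v`, which
        -- contains neither.
        count-C : ∀ S → χ S v ≡ χ S x → cnt S C ≡ cnt S l
        count-C S same = +-cancelˡ-≡ (χ S v) _ _ (≡-trans (cnt-↭ S vC↭xl) (cong (_+ cnt S l) (sym same)))

        better : ¬ t < cnt (neighbours G v) l
        better t<v = best (rp , ∼-sym w∼y ∙ (rB , ∼-sym x∼y₄ ∙ ([ x ] , x∼y₃ ∙ rev rq))) (∼-sym u∼y′)
          (Unique-++⁻ʳ (v ∷ []) vC-unique) (≡-trans (count-C X (same-∈ X v∈X x∈X)) l-count)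
          v∈X (Unique-disjoint (v ∷ []) vC-unique (here refl))
          (subst (t <_) (sym (count-C (neighbours G v) (same-∉ (neighbours G v) (X≁X v∈X v∈X) (X≁X v∈X x∈X)))) t<v)

        succ-of : ∀ {c} → c ∈ₗ U₁ → Succ l x c
        succ-of c∈ = U-succ (proj₁ (U₁⊆ c∈))

        apart-x-v : Apart R x v
        apart-x-v z z∈R x∼z v∼z = insert-over-chord (↭-reflexive (≡-trans (++-assoc p (v ∷ []) (q ++ B)) (sym l-cut)))
          (rp , y∼v ∙ [ v ]) (rq , y₃∼w ∙ rB) x∼y₄ u∼y′ v∼z x∼z (R-off z∈R)

        apart-v-succ : ∀ {c} → c ∈ₗ U₁ → Apart R v c
        apart-v-succ c∈ z z∈R v∼z c∼z = crossed-apart v∈X l-cut rp y∼v v∼y′ rq y₃∼w rB (w∼y) u∼y′ x∼y₃ x∼y₄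
          (succ-of c∈) (proj₂ (U₁⊆ c∈)) v∼z c∼z (X≢Y x∈X (X→Y v∈X v∼z)) (R-off z∈R)

        family : AllPairs (Apart R) (x ∷ v ∷ U₁)
        family =
          (apart-x-v ∷ All.tabulate (λ c∈ → apart-x-succ (succ-of c∈))) ∷
          All.tabulate apart-v-succ ∷
          unique⇒AllPairs U₁-unique (λ c∈ c′∈ → apart-succs (succ-of c∈) (succ-of c′∈))

    arcs-at : ∀ {S u l y} → Path u l y → y ∈ S → 2 ≤ cnt S l →
      ∃[ A ] ∃[ w ] ∃[ B ] ∃[ y₃ ] (l ≡ A ++ w ∷ B × Path u A y₃ × y₃ ∈ S × y₃ ∼ w × Path w (w ∷ B) y)
    arcs-at {S} {l = l} {y} r y∈S 2≤cnt = locate (first (≤-pred (subst (2 ≤_) cnt≡ 2≤cnt)))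
      where
      cnt≡ : cnt S l ≡ suc (length (succs S l))
      cnt≡ = ≡-trans (sym (length-succs S r)) (≡-trans (cong (length (succs S l) +_) (χ-∈ {S = S} y∈S)) (+-comm (length (succs S l)) 1))
      first : ∀ {k : List V} → 1 ≤ length k → ∃[ v ] v ∈ₗ k
      first {v ∷ _} _ = v , here refl
      locate : ∃[ w ] w ∈ₗ succs S l → _
      locate (w , w∈succs) with A , B , y₃ , l≡ , rA , y₃∈S , e , rB ← ∈-succs S r w∈succs =
        A , w , B , y₃ , l≡ , rA , y₃∈S , e , rB

    arcs-absurd : ∀ {u A y₃ w B y₄ x} → Best (cnt (neighbours G x) (A ++ B)) →
      Path u A y₃ → y₃ ∼ w → Path w B y₄ → y₄ ∼ u → Unique (A ++ B) → cnt X (A ++ B) ≡ k →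
      x ∈ X → x ∉ₗ A ++ B → x ∼ y₃ → x ∼ y₄ → 2 ≤ cnt (neighbours G x) (A ++ B) → ⊥
    arcs-absurd {A = A} {B = B} {x = x} best rA y₃∼w rB y₄∼u l-unique l-count x∈X x∉l x∼y₃ x∼y₄ 2≤t =
      decide (crossing-or-few u∈X w∈X rA u∈X (X→Y x∈X x∼y₃)) (crossing-or-few w∈X u∈X rB w∈X (X→Y x∈X x∼y₄))
      where
      open Arcs rA y₃∼w rB y₄∼u l-unique l-count x∈X x∉l x∼y₃ x∼y₄
      BA = ↭-++-comm A B
      decide : _ → _ → ⊥
      decide (inj₁ crossing) _               = crossed-absurd best 2≤t crossing
      decide (inj₂ _)        (inj₁ crossing) =
        -- A crossing on `B` is one on the first arc once the cycle is read from `w`.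
        Arcs.crossed-absurd rB y₄∼u rA y₃∼w (Unique-resp-↭ BA l-unique) (≡-trans (sym (cnt-↭ X BA)) l-count)
          x∈X (x∉l ∘ ∈-resp-↭ (↭-sym BA)) x∼y₄ x∼y₃
          (subst Best (cnt-↭ (neighbours G x) BA) best) (subst (2 ≤_) (cnt-↭ (neighbours G x) BA) 2≤t) crossing
      decide (inj₂ fewA)     (inj₂ fewB)     = few-edges-absurd fewA fewB

    best-absurd : ∀ {a l b x} → Best (cnt (neighbours G x) l) →
      Path a l b → b ∼ a → Unique l → cnt X l ≡ k → x ∈ X → x ∉ₗ l → 2 ≤ cnt (neighbours G x) l → ⊥
    best-absurd {x = x} best r e l-unique l-count x∈X x∉l 2≤t
      with y , y∈l , x∼y ← cnt-pos (neighbours G x) (<⇒≤ 2≤t)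
      with c , l′ , l′↭l , r′ , e′ ← rotate-to-end r e y∈l
      with l↭l′ ← ↭-sym l′↭l
      with A , w , B , y₃ , refl , rA , x∼y₃ , y₃∼w , rB ← arcs-at r′ x∼y (subst (2 ≤_) (cnt-↭ (neighbours G x) l↭l′) 2≤t) =
      arcs-absurd (subst Best (cnt-↭ (neighbours G x) l↭l′) best) rA y₃∼w rB e′ (Unique-resp-↭ l↭l′ l-unique)
        (≡-trans (cnt-↭ X l′↭l) l-count) x∈X (x∉l ∘ ∈-resp-↭ l′↭l) x∼y₃ x∼y (subst (2 ≤_) (cnt-↭ (neighbours G x) l↭l′) 2≤t)

    -- Instead of choosing an extremal pair of cycle and vertex, `descend` recurses on a bound `d`
    -- for the gap between `k` and the number of neighbours. A better pair narrows the gap; at gap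
    -- zero there is none, by `cnt-nbr≤k`.
    two-neighbours-absurd : ∀ {a l b x} → Path a l b → b ∼ a → Unique l → cnt X l ≡ k →
      x ∈ X → x ∉ₗ l → 2 ≤ cnt (neighbours G x) l → ⊥
    two-neighbours-absurd {l = l} {x = x} = descend k (m≤m+n k _)
      where
      descend : ∀ d {a l b x} → k ≤ d + cnt (neighbours G x) l → Path a l b → b ∼ a → Unique l → cnt X l ≡ k →
        x ∈ X → x ∉ₗ l → 2 ≤ cnt (neighbours G x) l → ⊥
      descend zero k≤t r e l-unique l-count x∈X x∉l 2≤t = best-absurd
        (λ r′ e′ u′ c′ v∈X _ t<t′ → <⇒≱ (≤-trans (s≤s k≤t) t<t′) (OffPart.cnt-nbr≤k u′ c′ (balanced r′ e′) v∈X))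
        r e l-unique l-count x∈X x∉l 2≤t
      descend (suc d) {l = l} {x = x} k≤ r e l-unique l-count x∈X x∉l 2≤t = best-absurd
        (λ r′ e′ u′ c′ v∈X v∉l t<t′ → descend d
          (≤-trans k≤ (≤-trans (≤-reflexive (sym (+-suc d _))) (+-monoʳ-≤ d t<t′)))
          r′ e′ u′ c′ v∈X v∉l (≤-trans 2≤t (<⇒≤ t<t′)))
        r e l-unique l-count x∈X x∉l 2≤t

    -- Excluding ears

    open EarCycles k longest two-neighbours-absurd

    frame-absurd : ∀ {u A c′ τ w B c τ′ e₁ E e₂ x} →
      Path u A c′ → Bridge c′ τ w → Path w B c → Bridge c τ′ u →
      Unique ((A ++ τ) ++ (B ++ τ′)) → cnt X ((A ++ τ) ++ (B ++ τ′)) ≡ k → u ∈ X → w ∈ X →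
      Path e₁ E e₂ → c ∼ e₁ → e₂ ∼ c′ → Unique E → (∀ {v} → v ∈ₗ E → v ∉ₗ (A ++ τ) ++ (B ++ τ′)) →
      x ∈ X → x ∈ₗ E → ⊥
    frame-absurd {u} {A} {c′} {τ} {w} {B} {c} {τ′} {e₁} {E} {e₂} {x}
      rA bA rB bB l-unique l-count u∈X w∈X rE c∼e₁ e₂∼c′ E-unique E-off x∈X x∈E
      with y₃ , rAτ , y₃∈Y , y₃∼w ← cross-bridge rA bA | y₄ , rBτ , y₄∈Y , y₄∼u ← cross-bridge rB bB =
      conclude (crossing-or-few u∈X w∈X rAτ u∈X y₃∈Y) (crossing-or-few w∈X u∈X rBτ w∈X y₄∈Y)
      where
      l : List V
      l = (A ++ τ) ++ (B ++ τ′)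
      l-swap : l ↭ (B ++ τ′) ++ (A ++ τ)
      l-swap = ↭-++-comm (A ++ τ) (B ++ τ′)
      E-reverse : E ↭ reverse E
      E-reverse = ↭-sym (↭-reverse E)
      module F = Frame rA bA rB bB l-unique l-count u∈X w∈X rE c∼e₁ e₂∼c′ E-unique E-off x∈X x∈E
      module F′ = Frame rB bB rA bA (Unique-resp-↭ l-swap l-unique) (≡-trans (sym (cnt-↭ X l-swap)) l-count) w∈X u∈X
        (rev rE) (∼-sym e₂∼c′) (∼-sym c∼e₁) (Unique-resp-↭ E-reverse E-unique)
        (λ v∈ v∈l → E-off (∈-resp-↭ (↭-reverse E) v∈) (∈-resp-↭ (↭-sym l-swap) v∈l)) x∈X (∈-resp-↭ E-reverse x∈E)
      open OffPart l-unique l-count (balanced (rAτ , y₃∼w ∙ rBτ) y₄∼u)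

      e₁≢e₂ : u ∼ e₁ → e₁ ≢ e₂
      -- An ear with equal ends consists of `x` alone, and then `u` would be adjacent to `x`, both
      -- in X.
      e₁≢e₂ u∼e₁ e₁≡e₂ = X≁X u∈X x∈X (subst (u ∼_) (sym (loop-trivial rE e₁≡e₂ E-unique x∈E)) u∼e₁)

      meets-both : ∀ {z} → z ∈ₗ E → u ∼ z → w ∼ z → ⊥
      meets-both z∈E u∼z w∼z =
        e₁≢e₂ (subst (u ∼_) (F.u-meets-ear-at-end z∈E u∼z) u∼z)
          (≡-trans (sym (F.u-meets-ear-at-end z∈E u∼z)) (F′.u-meets-ear-at-end (∈-resp-↭ E-reverse z∈E) w∼z))

      uw-apart : Apart R u w
      uw-apart z z∈R u∼z w∼z with z ∈ₗ? E
      ... | yes z∈E = meets-both z∈E u∼z w∼z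
      ... | no  z∉E = F.u-w-apart z∉E (R-off z∈R) u∼z w∼z

      xu-common : ∀ {z} → z ∈ₗ R → x ∼ z → u ∼ z → z ≡ e₁
      xu-common {z} z∈R x∼z u∼z with z ∈ₗ? E
      ... | yes z∈E = F.u-meets-ear-at-end z∈E u∼z
      ... | no  z∉E = ⊥-elim (F.u-x-apart z∉E (R-off z∈R) u∼z x∼z)

      xw-common : ∀ {z} → z ∈ₗ R → x ∼ z → w ∼ z → z ≡ e₂
      xw-common {z} z∈R x∼z w∼z with z ∈ₗ? E
      ... | yes z∈E = F′.u-meets-ear-at-end (∈-resp-↭ E-reverse z∈E) w∼z
      ... | no  z∉E = ⊥-elim (F′.u-x-apart (z∉E ∘ ∈-resp-↭ (↭-reverse E)) (R-off z∈R ∘ ∈-resp-↭ (↭-sym l-swap)) w∼z x∼z)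

      -- Off the cycle, `x` can share only `e₁` with `u` and only `e₂` with `w`, and by
      -- `both-ends-absurd` not both. The exceptional vertex is `e₁` if it is shared and `e₂`
      -- otherwise.
      off-bound : cnt (neighbours G x) R + (cnt (neighbours G u) R + cnt (neighbours G w) R) ≤ suc (cnt Y R)
      off-bound with (e₁ ∈? neighbours G u) ×-dec (e₁ ∈? neighbours G x)
      ... | yes (u∼e₁ , x∼e₁) = triple-bound e₁ R-unique x∈X u∈X w∈X uw-apart
        (λ z∈R z≢e₁ x∼z u∼z → z≢e₁ (xu-common z∈R x∼z u∼z))
        (λ z∈R _ x∼z w∼z → case xw-common z∈R x∼z w∼z of λ { refl → F.both-ends-absurd (e₁≢e₂ u∼e₁) u∼e₁ x∼e₁ w∼z x∼z })
      ... | no  not-both      = triple-bound e₂ R-unique x∈X u∈X w∈X uw-apart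
        (λ z∈R _ x∼z u∼z → case xu-common z∈R x∼z u∼z of λ { refl → not-both (u∼z , x∼z) })
        (λ z∈R z≢e₂ x∼z w∼z → z≢e₂ (xw-common z∈R x∼z w∼z))

      split-δ : ∀ {v} → v ∈ X → δ ≤ (cnt (neighbours G v) (A ++ τ) + cnt (neighbours G v) (B ++ τ′)) + cnt (neighbours G v) R
      split-δ {v} v∈X = subst (λ c → δ ≤ c + cnt (neighbours G v) R) (cnt-++ (neighbours G v) (A ++ τ) (B ++ τ′)) (δ≤cnt v∈X)

      conclude : _ → _ → ⊥
      conclude (inj₁ crossing) _               = F.crossing-absurd crossing
      conclude (inj₂ _)        (inj₁ crossing) = F′.crossing-absurd crossing
      conclude (inj₂ fewA)     (inj₂ fewB)     =
        ear-arith {a = cnt X (A ++ τ)} {b = cnt X (B ++ τ′)} {tx = cnt (neighbours G x) l} {ox = cnt (neighbours G x) R}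
          {ou = cnt (neighbours G u) R} {ow = cnt (neighbours G w) R}
          {uA = cnt (neighbours G u) (A ++ τ)} {wA = cnt (neighbours G w) (A ++ τ)}
          {uB = cnt (neighbours G u) (B ++ τ′)} {wB = cnt (neighbours G w) (B ++ τ′)}
          (δ≤cnt x∈X) (split-δ u∈X) (split-δ w∈X)
          (≤-pred (≰⇒> (two-neighbours-absurd (rAτ , y₃∼w ∙ rBτ) y₄∼u l-unique l-count x∈X (E-off x∈E))))
          fewA fewB off-bound
          (subst (λ c → (c + cnt Y R) + 5 ≤ 3 * δ) (≡-trans (sym l-count) (cnt-++ X (A ++ τ) (B ++ τ′))) k+R≤)

    -- This describes the arc after one end of the ear. In the case `follows` the arc is just the
    -- other end, so the ear fits between two consecutive vertices and lengthens the cycle;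
    -- `bridged` provides one half of a `Frame`.
    data Start (c a : V) (l : List V) (b : V) : Set where
      follows : a ≡ b → l ≡ a ∷ [] → Start c a l b
      bridged : ∀ τ {u A} → l ≡ τ ++ A → Path u A b → u ∈ X → Bridge c τ u → Start c a l b

    start : ∀ {c a l b} → c ∼ a → Path a l b → Start c a l b
    start {a = a} c∼a r with X⊎Y a
    ... | inj₁ a∈X = bridged [] refl r a∈X (edge (X→Y a∈X (∼-sym c∼a)) c∼a)
    start c∼a [ a ]   | inj₂ a∈Y = follows refl refl
    start c∼a (e ∷ r) | inj₂ a∈Y = bridged (_ ∷ []) refl r (Y→X a∈Y e) (via a∈Y c∼a e)

    module _ {l : List V} (l-unique : Unique l) (l-count : cnt X l ≡ k) (e : Ear l) where

      open Ear e

      inserted-absurd : ∀ {a C b} → Path a C b → b ∼ a → C ↭ l ++ E → ⊥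
      inserted-absurd {C = C} r b∼a C↭ = <⇒≱ k<C
        (longest r b∼a (Unique-resp-↭ (↭-sym C↭) (Unique-++⁺ l-unique E-unique (λ v∈l v∈E → E-off v∈E v∈l))))
        where
        k<C : k < cnt X C
        k<C = ≤-trans (≤-reflexive (+-comm 1 k)) (≤-trans (+-monoʳ-≤ k (∈⇒1≤cnt X x∈E x∈X)) (≤-reflexive
          (≡-trans (cong (_+ cnt X E) (sym l-count)) (≡-trans (sym (cnt-++ X l E)) (sym (cnt-↭ X C↭))))))

      ear-arcs-absurd : ∀ {a A b B} → A ++ B ↭ l → Path a A c′ → c′ ∼ b → Path b B c → c ∼ a → ⊥
      ear-arcs-absurd {a} {A} {b} {B} AB↭l rA c′∼b rB c∼a with start c∼a rA | start c′∼b rB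
      ... | follows refl refl | _ = inserted-absurd ((c′∼b ∷ rB) , c∼e₁ ∙ E-path) e₂∼c′ (↭-++⁺ AB↭l ↭-refl)
      ... | bridged _ _ _ _ _ | follows refl refl =
        inserted-absurd (rA , ∼-sym e₂∼c′ ∙ (rev E-path , ∼-sym c∼e₁ ∙ [ c ])) c∼a
          (↭-trans (rearrange (# 0F ⊕ ↶ # 2F ⊕ # 1F) ((# 0F ⊕ # 1F) ⊕ # 2F) refl (A ∷ (c ∷ []) ∷ E ∷ []))
            (↭-++⁺ AB↭l ↭-refl))
      ... | bridged τ′ {A = A°} refl rA° u∈X bB | bridged τ {A = B°} refl rB° w∈X bA =
        frame-absurd rA° bA rB° bB (Unique-resp-↭ (↭-sym frame↭l) l-unique) (≡-trans (cnt-↭ X frame↭l) l-count) u∈X w∈X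
          E-path c∼e₁ e₂∼c′ E-unique (λ v∈E v∈ → E-off v∈E (∈-resp-↭ frame↭l v∈)) x∈X x∈E
        where
        frame↭l : (A° ++ τ) ++ (B° ++ τ′) ↭ l
        frame↭l = ↭-trans (rearrange ((# 1F ⊕ # 2F) ⊕ # 3F ⊕ # 0F) ((# 0F ⊕ # 1F) ⊕ # 2F ⊕ # 3F) refl (τ′ ∷ A° ∷ τ ∷ B° ∷ []))
          AB↭l

      ear-absurd : ∀ {a b} → Path a l b → b ∼ a → ⊥
      ear-absurd r b∼a with a , l′ , l′↭l , r′ , c∼a ← rotate-to-end r b∼a c∈l with ∈-∃++ (∈-resp-↭ (↭-sym l′↭l) c′∈l)
      ... | p , []    , refl = c≢c′ (sym (end≡ [ c′ ] (suffix p r′)))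
      ... | p , b ∷ q , refl with rA , c′∼b , rB ← split-edge p r′ =
        ear-arcs-absurd (↭-trans (↭-reflexive (++-assoc p (c′ ∷ []) (b ∷ q))) l′↭l) rA c′∼b rB c∼a

    longest-absurd : (∀ c → ConnectedAfterDeleting G ⁅ c ⁆) →
      ∀ {a l b} → Path a l b → b ∼ a → Unique l → cnt X l ≡ k → ⊥
    longest-absurd connected {a} {l} r b∼a l-unique l-count =
      leftover (cnt-pos X (+-cancelˡ-≤ k 1 _ (≤-trans (≤-trans (≤-reflexive (+-comm k 1)) k<X)
        (≤-reflexive (≡-trans (split-count X) (cong (_+ cnt X R) l-count))))))
      where
      open OffPart l-unique l-count (balanced r b∼a)
      leftover : ∃[ x ] (x ∈ₗ R × x ∈ X) → ⊥
      leftover (x , x∈R , x∈X) =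
        ear-absurd l-unique l-count (ear connected (start∈ r) (end∈ r) (λ { refl → loopless G a b∼a }) x∈X (R-off x∈R)) r b∼a

-- Decidability of the conclusion and the final descent

module _ {N : ℕ} where

  open DecMembership (Fin._≟_ {N}) using () renaming (_∈?_ to _∈ₗ?_)

  -- Exhaustive search makes the existence of the required cycle decidable, so the theorem may be
  -- proved by refuting its negation.
  search : ∀ {P : List (Fin N) → Set} → (∀ c → Dec (P c)) → ∀ n → Dec (∃[ c ] (length c ≡ n × P c))
  search P? zero = map′ (λ p → [] , refl , p) (λ { ([] , _ , p) → p }) (P? [])
  search P? (suc n) = map′
    (λ { (v , c , len , p) → v ∷ c , cong suc len , p })
    (λ { (v ∷ c , len , p) → v , c , suc-injective len , p })
    (Fin.any? λ v → search (P? ∘ (v ∷_)) n)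

  closed? : ∀ (G : Graph N) c → Dec (Closed G c)
  closed? G []       = no λ ()
  closed? G (v ∷ ws) = map′ closed (λ { (closed l) → l }) (linked? (λ u w → w ∈? neighbours G u) ((v ∷ ws) ∷ʳ v))

  isCycle? : ∀ (G : Graph N) c → Dec (IsCycle G c)
  isCycle? G c = map′
    (λ (l , d , cl) → record { length≥3 = l ; distinct = d ; isClosed = cl })
    (λ z → IsCycle.length≥3 z , IsCycle.distinct z , IsCycle.isClosed z)
    ((3 ≤? length c) ×-dec (DecUnique.unique? Fin._≟_ c ×-dec closed? G c))

  contains? : ∀ (X : Subset N) c → Dec (∀ {x} → x ∈ X → x ∈ₗ c)
  contains? X c = map′ (λ h {x} → h x) (λ h x → h {x}) (Fin.all? λ x → (x ∈? X) →-dec (x ∈ₗ? c))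

theorem2 : ∀ (n m δ : ℕ) → n ≤ δ → δ ≤ m → m + 5 ≤ 3 * δ → 2 ≤ n →
    ∀ {N} (G : Graph N) (X Y : Subset N) → Bipartition G X Y →
    ∣ X ∣ ≡ n → ∣ Y ∣ ≡ m →
    (∀ {x} → x ∈ X → δ ≤ degree G x) →
    IsConnected G 2 →
    ∃[ c ] (IsCycle G c × length c ≡ 2 * n × (∀ {x} → x ∈ X → x ∈ₗ c))
theorem2 n m δ n≤δ δ≤m m+5≤3δ 2≤n {N} G X Y bip refl ∣Y∣≡m δ≤deg connected =
  decidable-stable
    (map′ (λ (c , len , cyc , X⊆c) → c , cyc , len , λ {x} → X⊆c {x}) (λ (c , cyc , len , X⊆c) → c , len , cyc , λ {x} → X⊆c {x})
      (search (λ c → isCycle? G c ×-dec contains? X c) (2 * ∣ X ∣)))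
    λ none → impossible none
  where
  open BipartiteGraph G X Y bip

  connected₁ : ∀ c → ConnectedAfterDeleting G ⁅ c ⁆
  connected₁ c = IsConnected.deletion connected ⁅ c ⁆ (s≤s (≤-reflexive (∣⁅x⁆∣≡1 c)))

  -- As X has at least two elements, it contains some `w` other than `x`. A walk from `z` to `w`
  -- survives the deletion of `x`, and its first step leads to the desired neighbour.
  second-neighbour : ∀ {z x} → z ∈ Y → x ∈ X → ∃[ v ] (z ∼ v × v ≢ x)
  second-neighbour {z} {x} z∈Y x∈X with R , split-count , _ , R-off , _ ← off-part {x ∷ []} ([] ∷ [])
    with w , w∈R , w∈X ← cnt-pos X (≤-pred (≤-trans 2≤n (≤-reflexive (≡-trans (split-count X)
           (cong (λ c → c + 0 + cnt X R) (χ-∈ x∈X)))))) =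
    step (connected₁ x (λ z∈ → X≢Y x∈X z∈Y (sym (x∈⁅y⁆⇒x≡y x z∈))) (λ w∈ → R-off w∈R (here (x∈⁅y⁆⇒x≡y x w∈))))
    where
    step : Star (AdjacentAvoiding G ⁅ x ⁆) z w → ∃[ v ] (z ∼ v × v ≢ x)
    step ε = ⊥-elim (X∌Y w∈X z∈Y)
    step ((_ , v∉ , z∼v) ◅ _) = _ , z∼v , λ { refl → v∉ (x∈⁅x⁆ x) }

  linked : ∀ {a l b c} → Path a l b → b ∼ c → Linked (Adjacent G) (l ∷ʳ c)
  linked [ _ ]         b∼c = b∼c ∷ [-]
  linked (e ∷ r) b∼c with _ , refl ← path-head r = e ∷ linked r b∼c

  spanning : ∀ {a l b} → Path a l b → b ∼ a → Unique l → cnt X l ≡ ∣ X ∣ →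
    ∃[ c ] (IsCycle G c × length c ≡ 2 * ∣ X ∣ × (∀ {x} → x ∈ X → x ∈ₗ c))
  spanning {l = l} r b∼a l-unique l-count with _ , refl ← path-head r
    with R , split-count , _ , _ , off-R ← off-part l-unique =
    -- Two-vertex cycles are excluded here: the length is twice the size of X, hence at least 4.
    l , record { length≥3 = ≤-trans (≤-trans (n≤1+n 3) (*-monoʳ-≤ 2 2≤n)) (≤-reflexive (sym len))
               ; distinct = l-unique ; isClosed = closed (linked r b∼a) } ,
    len , λ {x} x∈X → covers x∈X (x ∈ₗ? l)
    where
    len : length l ≡ 2 * ∣ X ∣
    len = ≡-trans (length≡cnt l) (cong₂ _+_ l-count (≡-trans (sym (balanced r b∼a)) (≡-trans l-count (sym (+-identityʳ ∣ X ∣)))))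
    covers : ∀ {x} → x ∈ X → Dec (x ∈ₗ l) → x ∈ₗ l
    covers x∈X (yes x∈l) = x∈l
    covers x∈X (no  x∉l) = ⊥-elim (m+1+n≰m ∣ X ∣ (≤-trans (+-monoʳ-≤ ∣ X ∣ (∈⇒1≤cnt X (off-R x∉l) x∈X))
      (≤-reflexive (≡-trans (cong (_+ cnt X R) (sym l-count)) (sym (split-count X))))))

  module _ (none : ¬ (∃[ c ] (IsCycle G c × length c ≡ 2 * ∣ X ∣ × (∀ {x} → x ∈ X → x ∈ₗ c)))) where

    -- Descent on a bound `d` for the number of vertices of X missed by `l`. Cycles with more
    -- vertices of X are refuted recursively, so `l` may be taken as longest and `Dense` applies to
    -- it.
    no-cycle : ∀ d {a l b} → ∣ X ∣ ≤ d + cnt X l → Path a l b → b ∼ a → Unique l → ⊥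
    no-cycle d {l = l} X≤ r b∼a l-unique with m≤n⇒m<n∨m≡n cnt≤X
      where
      cnt≤X : cnt X l ≤ ∣ X ∣
      cnt≤X with R , split-count , _ ← off-part l-unique = subst (cnt X l ≤_) (sym (split-count X)) (m≤m+n _ _)
    ... | inj₂ all-X = none (spanning r b∼a l-unique all-X)
    no-cycle zero    X≤ r b∼a l-unique | inj₁ k<X = <⇒≱ k<X X≤
    no-cycle (suc d) {l = l} X≤ r b∼a l-unique | inj₁ k<X =
      Dense.longest-absurd (cnt X l)
        (λ r′ e′ u′ → ≮⇒≥ λ k<c → no-cycle d (≤-trans X≤ (≤-trans (≤-reflexive (sym (+-suc d _))) (+-monoʳ-≤ d k<c))) r′ e′ u′)
        m δ k<X n≤δ ∣Y∣≡m m+5≤3δ δ≤deg second-neighbour connected₁ r b∼a l-unique refl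

    impossible : ⊥
    -- The descent starts from an edge at a vertex of X, taken as a two-vertex cycle.
    impossible with x , _ , x∈X ← cnt-pos X {allFin N} (≤-trans (<⇒≤ 2≤n) (≤-reflexive (cnt-allFin X)))
      with y , _ , x∼y ← cnt-pos (neighbours G x) {allFin N}
        (≤-trans (≤-trans (<⇒≤ 2≤n) (≤-trans n≤δ (δ≤deg x∈X))) (≤-reflexive (cnt-allFin (neighbours G x)))) =
      no-cycle ∣ X ∣ (m≤m+n _ _) (x∼y ∷ [ y ]) (∼-sym x∼y) ((X≢Y x∈X (X→Y x∈X x∼y) ∷ []) ∷ [] ∷ [])
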